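{- For every $\varepsilon,\alpha>0$ there exists $n_0=n_0(\varepsilon,\alpha)$ such that the following holds for every standard multigraph $M=(V,E)$ on $n\ge n_0$ vertices with $n$ divisible by $3$: if $\delta(M)\geq\left(\frac43+\varepsilon\right)n$ and $H_M$ is not $\alpha$-splittable, then $M$ has a $5$-triangle factor.
   Context: Multigraphs have no loops; $\mu(x,y)$ is the number of edges with ends $x,y$. $M$ is standard if $\mu(x,y)\le2$ for all $x,y$. The degree of $x$ is $d(x)=\sum_y\mu(x,y)$ and $\delta(M)=\min_x d(x)$. $H_M$ is the simple graph on $V$ whose edges are the pairs $xy$ with $\mu(x,y)=2$. A simple graph $G$ on $n$ vertices is $\alpha$-splittable if there is a partition $\{A,B\}$ of $V(G)$ with $|A|,|B|\ge\frac n3$ and the number of edges of $G$ with one end in $A$ and the other in $B$ at most $\alpha n^2$. A $5$-triangle is a multigraph on three vertices containing a triangle $C_3$ and having exactly $5$ edges counted with multiplicity. A $5$-triangle factor of $M$ is a set of pairwise vertex-disjoint sub-multigraphs of $M$, each a $5$-triangle, whose vertex sets cover $V$ (equivalently, a partition of $V$ into triples $\{x,y,z\}$ that are pairwise adjacent with $\mu(x,y)+\mu(y,z)+\mu(x,z)\ge5$). -}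

module Defs where

open import Data.Nat as ℕ using (ℕ; _≤_)
open import Data.Bool using (Bool; true; false; if_then_else_; not)
open import Data.Fin using (Fin)
open import Data.List using (List; []; _∷_; map; allFin; concatMap)
open import Data.Nat.ListAction using (sum)
open import Data.Product using (_×_; _,_; Σ; ∃; ∃-syntax)
open import Data.Integer using (+_)
open import Data.Rational as ℚ using (ℚ; _/_)
open import Relation.Nullary using (¬_)
open import Relation.Nullary.Decidable using (⌊_⌋)
open import Relation.Binary.PropositionalEquality using (_≡_)
open import Data.List.Relation.Binary.Permutation.Propositional using (_↭_)

record Multigraph (n : ℕ) : Set where
  field
    μ        : Fin n → Fin n → ℕ
    symmetric : ∀ x y → μ x y ≡ μ y x
    loopless  : ∀ x → μ x x ≡ 0
open Multigraph public

Standard : ∀ {n} → Multigraph n → Set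
Standard {n} M = ∀ (x y : Fin n) → μ M x y ≤ 2

degree : ∀ {n} → Multigraph n → Fin n → ℕ
degree {n} M x = sum (map (μ M x) (allFin n))

ℕtoℚ : ℕ → ℚ
ℕtoℚ k = + k / 1

-- δ(M) ≥ c  (δ is the minimum degree; for n ≥ 1 this is equivalent)
MinDegreeAtLeast : ∀ {n} → Multigraph n → ℚ → Set
MinDegreeAtLeast {n} M c = ∀ (x : Fin n) → c ℚ.≤ ℕtoℚ (degree M x)

-- adjacency in H_M: μ(x,y) = 2
isDouble : ℕ → Bool
isDouble k = ⌊ k ℕ.≟ 2 ⌋

sizeOf : ∀ {n} → (Fin n → Bool) → ℕ
sizeOf {n} A = sum (map (λ x → if A x then 1 else 0) (allFin n))

-- number of edges of H_M with one end in A and the other in B = V ∖ A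
-- (each such edge counted once, via the ordered pair (a ∈ A, b ∈ B))
crossEdgesH : ∀ {n} → Multigraph n → (Fin n → Bool) → ℕ
crossEdgesH {n} M A =
  sum (map (λ x → sum (map (λ y →
        if A x then (if not (A y) then (if isDouble (μ M x y) then 1 else 0) else 0) else 0)
      (allFin n))) (allFin n))

AlphaSplittableH : ∀ {n} → Multigraph n → ℚ → Set
AlphaSplittableH {n} M α =
  ∃[ A ] ( (ℕtoℚ n ℚ.≤ ℕtoℚ (3 ℕ.* sizeOf A))
         × (ℕtoℚ n ℚ.≤ ℕtoℚ (3 ℕ.* (n ℕ.∸ sizeOf A)))
         × (ℕtoℚ (crossEdgesH M A) ℚ.≤ α ℚ.* ℕtoℚ (n ℕ.* n)) )

FiveTriangle : ∀ {n} → Multigraph n → Fin n × Fin n × Fin n → Set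
FiveTriangle M (x , y , z) =
  (1 ≤ μ M x y) × (1 ≤ μ M y z) × (1 ≤ μ M x z) × (5 ≤ μ M x y ℕ.+ μ M y z ℕ.+ μ M x z)

triVertices : ∀ {n} → Fin n × Fin n × Fin n → List (Fin n)
triVertices (x , y , z) = x ∷ y ∷ z ∷ []

FiveTriangleFactor : ∀ {n} → Multigraph n → Set
FiveTriangleFactor {n} M =
  Σ (List (Fin n × Fin n × Fin n)) λ T →
    (concatMap triVertices T ↭ allFin n)
    × (∀ t → t Data.List.Membership.Propositional.∈ T → FiveTriangle M t)
  where import Data.List.Membership.Propositional

{-# OPTIONS --safe #-}

-- Fix naturals e, a with 1/e ≤ ε and 1/a ≤ α. The factor is found by absorption, without randomness.
--
-- Near tiling.  Cover the vertices by 5-triangles, disjoint double edges and single vertices so that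
-- 3 · #tiles + #double edges cannot be increased by a local exchange. Then a tile receives weight at
-- most 8 per double edge and 4 per single, up to an additive constant, while the minimum degree forces
-- more than that on average; so only O(e) vertices stay uncovered.
--
-- Linking.  Call x, y exchangeable if many pairs complete both x and y to a 5-triangle. A linear
-- codegree in H suffices, and a pair that is not exchangeable forces a quadratic number of triangles of
-- H at each of its ends. Among any three vertices two have linear codegree, so if x and y cannot be
-- linked through one middle vertex, the vertices exchangeable with x and the remaining ones form a
-- partition as in the definition of splittability. The many edges of H across it, or the
-- triangles of H at their ends, give many cherries (paths of length two) of H with ends on both sides,
-- hence many exchangeable pairs across it, and x and y are linked through two middle vertices.
--
-- Absorption.  Hence every triple of vertices has Ω(n²⁷) absorbers. Greedily choosing an absorber that
-- serves a constant proportion of the triples not yet served exhausts all n³ triples in o(n) steps.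
-- A bounded number of repetitions absorbs whatever the near tiling leaves over.

module Submission where

open import Defs
open import Algebra.Bundles using (CommutativeMonoid)
import Algebra.Solver.CommutativeMonoid as CMSolver
open import Data.Bool using (Bool; true; false; if_then_else_; not; _∧_; _∨_; T)
open import Data.Empty using (⊥; ⊥-elim)
open import Data.Fin using (Fin)
import Data.Integer as ℤ
import Data.Integer.Properties as ℤ
open import Data.List using (List; []; _∷_; [_]; map; allFin; concatMap; length; _++_; cartesianProduct)
open import Data.List.Membership.Propositional using (_∈_)
open import Data.List.Membership.Propositional.Properties
  using (∈-++⁻; ∈-++⁺ʳ; ∈-∃++; ∈-cartesianProduct⁺; ∈-allFin)
open import Data.List.Properties using (map-++; length-tabulate; length-++; concatMap-++; length-map; ++-assoc; ++-identityʳ)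
open import Data.List.Relation.Binary.Permutation.Propositional
  using (_↭_; ↭-refl; ↭-sym; ↭-trans; ↭-reflexive; prep; swap)
  renaming (trans to ↭-step; refl to ↭-done)
open import Data.List.Relation.Binary.Permutation.Propositional.Properties
  using (map⁺; ++⁺; ++⁺ˡ; ++⁺ʳ; shift; ↭-length; ++-isCommutativeMonoid; ∈-resp-↭)
open import Data.List.Relation.Unary.All as All using (All; []; _∷_)
open import Data.List.Relation.Unary.Any using (here; there)
open import Data.Nat using
  (ℕ; zero; suc; _+_; _*_; _∸_; _^_; _≤_; _<_; _≤ᵇ_; z≤n; s≤s; s≤s⁻¹; NonZero; >-nonZero; >-nonZero⁻¹; pred)
open import Data.Nat.Coprimality using (Coprime)
open import Data.Nat.Divisibility using (_∣_; divides; ∣m+n∣m⇒∣n; n∣m*n)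
open import Data.Nat.DivMod using (_/_; _%_; m≡m%n+[m/n]*n; m%n<n)
open import Data.Nat.ListAction using (sum)
open import Data.Nat.ListAction.Properties using (sum-++; sum-↭)
open import Data.Nat.Properties
open import Data.Nat.Tactic.RingSolver using (solve-∀)
open import Data.Product using (_×_; _,_; proj₁; proj₂; Σ; ∃)
open import Data.Rational as ℚ using (ℚ; mkℚ; 0ℚ; toℚᵘ)
import Data.Rational.Properties as ℚ
open import Data.Rational.Unnormalised as ℚᵘ using (mkℚᵘ)
import Data.Rational.Unnormalised.Properties as ℚᵘ
open import Data.Sum using (_⊎_; inj₁; inj₂)
open import Data.Unit using (tt)
open import Relation.Nullary using (¬_; yes; no)
open import Relation.Binary.PropositionalEquality using (_≡_; refl; sym; trans; cong; cong₂; subst; subst₂)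

-- A linear-arithmetic step: l ≤ r follows from L ≤ R once r − l = (R − L) + s is a semiring identity.
linear : ∀ {L R} l r s → L ≤ R → l + R + s ≡ r + L → l ≤ r
linear {L} {R} l r s L≤R eq = +-cancelʳ-≤ R l r
  (≤-trans (m≤m+n (l + R) s) (≤-trans (≤-reflexive eq) (+-monoʳ-≤ r L≤R)))

-- Indicators and finite sums over lists.

ι : Bool → ℕ
ι b = if b then 1 else 0

ι≤1 : ∀ b → ι b ≤ 1
ι≤1 true = s≤s z≤n
ι≤1 false = z≤n

∑ : {A : Set} → List A → (A → ℕ) → ℕ
∑ xs f = sum (map f xs)

module _ {A : Set} where

  ∑-mono∈ : ∀ (xs : List A) {f g : A → ℕ} → (∀ x → x ∈ xs → f x ≤ g x) → ∑ xs f ≤ ∑ xs g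
  ∑-mono∈ [] h = z≤n
  ∑-mono∈ (x ∷ xs) h = +-mono-≤ (h x (here refl)) (∑-mono∈ xs (λ y y∈ → h y (there y∈)))

  ∑-mono : ∀ (xs : List A) {f g : A → ℕ} → (∀ x → f x ≤ g x) → ∑ xs f ≤ ∑ xs g
  ∑-mono xs h = ∑-mono∈ xs (λ x _ → h x)

  ∑-cong : ∀ (xs : List A) {f g : A → ℕ} → (∀ x → f x ≡ g x) → ∑ xs f ≡ ∑ xs g
  ∑-cong [] h = refl
  ∑-cong (x ∷ xs) h = cong₂ _+_ (h x) (∑-cong xs h)

  ∑-+ : ∀ (xs : List A) (f g : A → ℕ) → ∑ xs (λ x → f x + g x) ≡ ∑ xs f + ∑ xs g
  ∑-+ [] f g = refl
  ∑-+ (x ∷ xs) f g rewrite ∑-+ xs f g = interchange (f x) (g x) (∑ xs f) (∑ xs g)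
    where
    interchange : ∀ a b c d → (a + b) + (c + d) ≡ (a + c) + (b + d)
    interchange = solve-∀

  ∑-*ˡ : ∀ (xs : List A) c (f : A → ℕ) → ∑ xs (λ x → c * f x) ≡ c * ∑ xs f
  ∑-*ˡ [] c f = sym (*-zeroʳ c)
  ∑-*ˡ (x ∷ xs) c f rewrite ∑-*ˡ xs c f = sym (*-distribˡ-+ c (f x) (∑ xs f))

  ∑-*ʳ : ∀ (xs : List A) c (f : A → ℕ) → ∑ xs (λ x → f x * c) ≡ ∑ xs f * c
  ∑-*ʳ xs c f = trans (∑-cong xs (λ x → *-comm (f x) c)) (trans (∑-*ˡ xs c f) (*-comm c _))

  ∑-const : ∀ (xs : List A) c → ∑ xs (λ _ → c) ≡ length xs * c
  ∑-const [] c = refl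
  ∑-const (x ∷ xs) c = cong (c +_) (∑-const xs c)

  ∑-≤const : ∀ (xs : List A) {f c} → (∀ x → f x ≤ c) → ∑ xs f ≤ length xs * c
  ∑-≤const xs {c = c} h = ≤-trans (∑-mono xs h) (≤-reflexive (∑-const xs c))

  ∑-affine : ∀ (xs : List A) a b {f g : A → ℕ} → (∀ x → f x ≤ a + b * g x) →
    ∑ xs f ≤ length xs * a + b * ∑ xs g
  ∑-affine xs a b {f} {g} h = ≤-trans (∑-mono xs h)
    (≤-reflexive (trans (∑-+ xs (λ _ → a) (λ x → b * g x)) (cong₂ _+_ (∑-const xs a) (∑-*ˡ xs b g))))

  ∑-++ : ∀ (xs ys : List A) (f : A → ℕ) → ∑ (xs ++ ys) f ≡ ∑ xs f + ∑ ys f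
  ∑-++ xs ys f = trans (cong sum (map-++ f xs ys)) (sum-++ (map f xs) (map f ys))

  ∑-↭ : ∀ {xs ys : List A} (f : A → ℕ) → xs ↭ ys → ∑ xs f ≡ ∑ ys f
  ∑-↭ f p = sum-↭ (map⁺ f p)

  ∑-concatMap : ∀ {B : Set} (k : B → List A) (ts : List B) (f : A → ℕ) →
    ∑ (concatMap k ts) f ≡ ∑ ts (λ t → ∑ (k t) f)
  ∑-concatMap k [] f = refl
  ∑-concatMap k (t ∷ ts) f =
    trans (∑-++ (k t) (concatMap k ts) f) (cong (∑ (k t) f +_) (∑-concatMap k ts f))

∑-swap : ∀ {A B : Set} (xs : List A) (ys : List B) (f : A → B → ℕ) →
  ∑ xs (λ x → ∑ ys (f x)) ≡ ∑ ys (λ y → ∑ xs (λ x → f x y))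
∑-swap [] ys f = sym (trans (∑-const ys 0) (*-zeroʳ (length ys)))
∑-swap (x ∷ xs) ys f =
  trans (cong (∑ ys (f x) +_) (∑-swap xs ys f)) (sym (∑-+ ys (f x) (λ y → ∑ xs (λ x → f x y))))

length-allFin : ∀ n → length (allFin n) ≡ n
length-allFin n = length-tabulate (λ x → x)

-- Exhaustive checks on multiplicities, and lists up to permutation.

T∧ : ∀ a {b} → T (a ∧ b) → T a × T b
T∧ true t = tt , t

∧≡true : ∀ a b → a ∧ b ≡ true → a ≡ true × b ≡ true
∧≡true true b e = refl , e

∀≤2 : (ℕ → Bool) → Bool
∀≤2 p = p 0 ∧ p 1 ∧ p 2

-- Exhaustive evaluation over multiplicities: a decidable property of numbers at most 2 is proved by running it.
check₁ : (p : ℕ → Bool) → T (∀≤2 p) → ∀ {a} → a ≤ 2 → T (p a)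
check₁ p t {0} h = proj₁ (T∧ (p 0) t)
check₁ p t {1} h = proj₁ (T∧ (p 1) (proj₂ (T∧ (p 0) t)))
check₁ p t {2} h = proj₂ (T∧ (p 1) (proj₂ (T∧ (p 0) t)))
check₁ p t {suc (suc (suc a))} (s≤s (s≤s ()))

check₂ : (p : ℕ → ℕ → Bool) → T (∀≤2 λ a → ∀≤2 (p a)) → ∀ {a b} → a ≤ 2 → b ≤ 2 → T (p a b)
check₂ p t {a} ha hb = check₁ (p a) (check₁ (λ a → ∀≤2 (p a)) t ha) hb

check₃ : (p : ℕ → ℕ → ℕ → Bool) → T (∀≤2 λ a → ∀≤2 λ b → ∀≤2 (p a b)) →
  ∀ {a b c} → a ≤ 2 → b ≤ 2 → c ≤ 2 → T (p a b c)
check₃ p t {a} ha = check₂ (p a) (check₁ (λ a → ∀≤2 λ b → ∀≤2 (p a b)) t ha)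

check₄ : (p : ℕ → ℕ → ℕ → ℕ → Bool) → T (∀≤2 λ a → ∀≤2 λ b → ∀≤2 λ c → ∀≤2 (p a b c)) →
  ∀ {a b c d} → a ≤ 2 → b ≤ 2 → c ≤ 2 → d ≤ 2 → T (p a b c d)
check₄ p t {a} ha = check₃ (p a) (check₁ (λ a → ∀≤2 λ b → ∀≤2 λ c → ∀≤2 (p a b c)) t ha)

infixr 4 _⇒ᵇ_
_⇒ᵇ_ : Bool → Bool → Bool
true  ⇒ᵇ b = b
false ⇒ᵇ b = true

modus : ∀ {a b} → T (a ⇒ᵇ b) → T a → T b
modus {true} h _ = h

-- Vertex sets are handled as lists up to permutation; the solver for this commutative monoid
-- carries out the regroupings below.
bag : Set → CommutativeMonoid _ _
bag A = record { isCommutativeMonoid = ++-isCommutativeMonoid {A = A} }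

module ↭-Solver {A : Set} = CMSolver (bag A)
  renaming (solve to bagSolve)

∈-split : ∀ {A : Set} {x : A} {xs} → x ∈ xs → ∃ λ ys → xs ↭ x ∷ ys
∈-split {x = x} x∈ with ∈-∃++ x∈
... | as , bs , refl = as ++ bs , shift x as bs

-- Pigeonhole by induction: a head below `m` leaves a tail whose average is still at least `m`.
average : ∀ {A : Set} (x : A) xs (f : A → ℕ) m → length (x ∷ xs) * m ≤ ∑ (x ∷ xs) f →
  ∃ λ u → u ∈ x ∷ xs × m ≤ f u
average x [] f m h = x , here refl , +-cancelʳ-≤ 0 m (f x) h
average x (y ∷ xs) f m h with m ≤? f x
... | yes m≤ = x , here refl , m≤
... | no m≰ with average y xs f m (+-cancelˡ-≤ m _ _ (≤-trans h (+-monoˡ-≤ _ (<⇒≤ (≰⇒> m≰)))))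
... | u , u∈ , m≤ = u , there u∈ , m≤

-- Absorption: dense families of tuples, absorbers, greedy absorbing sets.

module Absorbing {n : ℕ} (M : Multigraph n) (D : ℕ) (0<n : 0 < n) where

  open ↭-Solver {Fin n}

  V : List (Fin n)
  V = allFin n

  -- The list may repeat vertices, so tuples and absorbers need not avoid one another. Disjointness
  -- is enforced where tuples are drawn from a remainder of `V`, and `Tileable V` is the required
  -- factor.
  Tileable : List (Fin n) → Set
  Tileable ws = Σ (List (Fin n × Fin n × Fin n)) λ ts →
    (concatMap triVertices ts ↭ ws) × (∀ t → t ∈ ts → FiveTriangle M t)

  tileable-[] : Tileable []
  tileable-[] = [] , ↭-refl , λ _ ()

  tileable-triple : ∀ {t} → FiveTriangle M t → Tileable (triVertices t)
  tileable-triple {t} f = [ t ] , ↭-refl , λ { _ (here refl) → f }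

  tileable-++ : ∀ {xs ys} → Tileable xs → Tileable ys → Tileable (xs ++ ys)
  tileable-++ (ts , p , f) (us , q , g) = ts ++ us ,
    ↭-trans (↭-reflexive (concatMap-++ triVertices ts us)) (++⁺ p q) ,
    λ t t∈ → h t (∈-++⁻ ts t∈)
    where
    h : ∀ t → t ∈ ts ⊎ t ∈ us → FiveTriangle M t
    h t (inj₁ i) = f t i
    h t (inj₂ i) = g t i

  tileable-↭ : ∀ {xs ys} → xs ↭ ys → Tileable xs → Tileable ys
  tileable-↭ p (ts , q , f) = ts , ↭-trans q p , f

  3∣tileable : ∀ {xs} → Tileable xs → 3 ∣ length xs
  3∣tileable (ts , p , _) = divides (length ts) (trans (sym (↭-length p)) (length-tri ts))
    where
    length-tri : ∀ ts → length (concatMap triVertices ts) ≡ length ts * 3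
    length-tri [] = refl
    length-tri (t ∷ ts) = cong (λ l → 3 + l) (length-tri ts)

  -- "A positive proportion of k-tuples" as nested densities, so that a tuple can be chosen one vertex at a
  -- time with a constant loss at each choice.
  Many : ℕ → (List (Fin n) → Set) → Set
  Many zero P = P []
  Many (suc k) P = Σ (Fin n → Bool) λ A → n ≤ D * sizeOf A ×
    (∀ u → A u ≡ true → Many k (λ us → P (u ∷ us)))

  many-map : ∀ k {P Q : List (Fin n) → Set} → (∀ us → P us → Q us) → Many k P → Many k Q
  many-map zero f p = f [] p
  many-map (suc k) f (A , big , g) = A , big , λ u Au → many-map k (λ us → f (u ∷ us)) (g u Au)

  many-bind : ∀ k l {P Q : List (Fin n) → Set} → Many k P →
    (∀ us → P us → Many l (λ vs → Q (us ++ vs))) → Many (k + l) Q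
  many-bind zero l p f = f [] p
  many-bind (suc k) l (A , big , g) f = A , big , λ u Au → many-bind k l (g u Au) (λ us → f (u ∷ us))

  Exchange : ℕ → List (Fin n) → List (Fin n) → Set
  Exchange k xs ys = Many k (λ ws → Tileable (xs ++ ws) × Tileable (ys ++ ws))

  exchange-++ : ∀ k l {xs ys xs′ ys′} → Exchange k xs ys → Exchange l xs′ ys′ →
    Exchange (k + l) (xs ++ xs′) (ys ++ ys′)
  exchange-++ k l {xs} {ys} {xs′} {ys′} e e′ = many-bind k l e λ ps (p , q) →
    many-map l (λ qs (p′ , q′) → tileable-↭ (interchange xs ps xs′ qs) (tileable-++ p p′) ,
                                 tileable-↭ (interchange ys ps ys′ qs) (tileable-++ q q′)) e′
    where
    interchange : ∀ as bs cs ds → (as ++ bs) ++ (cs ++ ds) ↭ (as ++ cs) ++ (bs ++ ds)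
    interchange = bagSolve 4 (λ a b c d → (a ⊕ b) ⊕ (c ⊕ d) ⊜ (a ⊕ c) ⊕ (b ⊕ d)) ↭-refl

  -- x and y exchange through the middle vertex u: the set {u} ∪ ps ∪ qs is completed by x as
  -- (x ps)(u qs) and by y as (u ps)(y qs).
  exchange-via : ∀ k l {x y} (A : Fin n → Bool) → n ≤ D * sizeOf A →
    (∀ u → A u ≡ true → Exchange k [ x ] [ u ] × Exchange l [ u ] [ y ]) →
    Exchange (suc (k + l)) [ x ] [ y ]
  exchange-via k l {x} {y} A big f = A , big , λ u Au →
    many-bind k l (proj₁ (f u Au)) λ ps (p , q) →
      many-map l (λ qs (p′ , q′) → tileable-↭ (eq₁ [ x ] [ u ] ps qs) (tileable-++ p p′) ,
                                   tileable-↭ (eq₂ [ y ] [ u ] ps qs) (tileable-++ q q′))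
        (proj₂ (f u Au))
    where
    eq₁ : ∀ x u ps qs → (x ++ ps) ++ (u ++ qs) ↭ x ++ u ++ ps ++ qs
    eq₁ = bagSolve 4 (λ x u ps qs → (x ⊕ ps) ⊕ (u ⊕ qs) ⊜ x ⊕ (u ⊕ (ps ⊕ qs))) ↭-refl
    eq₂ : ∀ y u ps qs → (u ++ ps) ++ (y ++ qs) ↭ y ++ u ++ ps ++ qs
    eq₂ = bagSolve 4 (λ y u ps qs → (u ⊕ ps) ⊕ (y ⊕ qs) ⊜ y ⊕ (u ⊕ (ps ⊕ qs))) ↭-refl

  -- A tuple that tiles by itself can be appended to both completions. This brings links of
  -- different lengths to a common length.
  exchange-pad : ∀ k l {x y} → Exchange k x y → Many l Tileable → Exchange (k + l) x y
  exchange-pad k l {x} {y} e m = many-bind k l e λ ps (p , q) →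
    many-map l (λ ts t → tileable-↭ (++-assoc′ x ps ts) (tileable-++ p t) ,
                         tileable-↭ (++-assoc′ y ps ts) (tileable-++ q t)) m
    where
    ++-assoc′ : ∀ (as bs cs : List (Fin n)) → (as ++ bs) ++ cs ↭ as ++ (bs ++ cs)
    ++-assoc′ as bs cs = ↭-reflexive (++-assoc as bs cs)

  Absorbs : Fin n × Fin n × Fin n → List (Fin n) → Set
  Absorbs t ws = Tileable ws × Tileable (triVertices t ++ ws)

  -- An absorber of t is a 5-triangle together with, for each of its vertices, a set exchanging
  -- that vertex for a vertex of t.
  many-absorbers : ∀ g → Many 3 Tileable → (∀ x y → Exchange g [ x ] [ y ]) →
    ∀ t → Many (3 + (g + (g + g))) (Absorbs t)
  many-absorbers g m e (x₁ , x₂ , x₃) = many-bind 3 (g + (g + g)) {Q = Absorbs (x₁ , x₂ , x₃)} m′ exchangeAll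
    where
    -- The list delivered by `Many 3` is exposed as three vertices, to be matched with those of the
    -- triple.
    m′ : Many 3 (λ ys → ∃ λ y₁ → ∃ λ y₂ → ∃ λ y₃ → ys ≡ y₁ ∷ y₂ ∷ y₃ ∷ [] × Tileable ys)
    m′ = let A , big , f = m in A , big , λ u Au → proj₁ (f u Au) , proj₁ (proj₂ (f u Au)) , λ v Bv →
      let (C , big′ , h) = proj₂ (proj₂ (f u Au)) v Bv in C , big′ , λ w Cw → u , v , w , refl , h w Cw
    rotate : ∀ xs ys ps → (xs ++ ps) ++ ys ↭ xs ++ (ys ++ ps)
    rotate = bagSolve 3 (λ xs ys ps → (xs ⊕ ps) ⊕ ys ⊜ xs ⊕ (ys ⊕ ps)) ↭-refl
    exchangeAll : ∀ ys → (∃ λ y₁ → ∃ λ y₂ → ∃ λ y₃ → ys ≡ y₁ ∷ y₂ ∷ y₃ ∷ [] × Tileable ys) →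
      Many (g + (g + g)) (λ ps → Absorbs (x₁ , x₂ , x₃) (ys ++ ps))
    exchangeAll ys (y₁ , y₂ , y₃ , refl , tys) =
      many-map (g + (g + g)) (λ ps (p , q) → q , tileable-↭ (rotate (x₁ ∷ x₂ ∷ x₃ ∷ []) ys ps) (tileable-++ p tys))
        (exchange-++ g (g + g) (e x₁ y₁) (exchange-++ g g (e x₂ y₂) (e x₃ y₃)))

  module _ {I : Set} where

    Items : ℕ → (I → List (Fin n) → Set) → Set
    Items k P = List (Σ I λ i → Many k (P i))

    covers : ∀ k (P : I → List (Fin n) → Set) → (Σ I λ i → Many (suc k) (P i)) → Fin n → ℕ
    covers k P (_ , A , _) u = ι (A u)

    -- Fixing `u` as the next vertex keeps in `Y` the items that continue through `u`, with their
    -- remaining densities, and drops the others into `Z`.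
    restrict : ∀ k (P : I → List (Fin n) → Set) u (X : Items (suc k) P) →
      Σ (Items k (λ i us → P i (u ∷ us))) λ Y → Σ (List I) λ Z →
        (map proj₁ X ↭ map proj₁ Y ++ Z) × length Y ≡ ∑ X (λ i → covers k P i u)
    restrict k P u [] = [] , [] , ↭-refl , refl
    restrict k P u ((i , A , big , f) ∷ X) with restrict k P u X | A u in Au
    ... | Y , Z , p , l | true = (i , f u Au) ∷ Y , Z , prep i p , cong suc l
    ... | Y , Z , p , l | false = Y , i ∷ Z , ↭-trans (prep i p) (↭-sym (shift i (map proj₁ Y) Z)) , l

    -- Vertices are fixed one at a time. An item continues through at least n/(2D) vertices of `R`,
    -- since the used vertices `U` block at most that many of its n/D. Averaging over `R` finds a
    -- vertex that keeps a share 1/(2D) of the items.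
    select : ∀ k (P : I → List (Fin n) → Set) (X : Items k P) → 0 < length X →
      ∀ U R → U ++ R ↭ V → 2 * D * (length U + k) ≤ n →
      Σ (List (Fin n)) λ ws → Σ (List (Fin n)) λ R′ → Σ (List I) λ Y → Σ (List I) λ Z →
        R ↭ ws ++ R′ × length ws ≡ k × map proj₁ X ↭ Y ++ Z × All (λ i → P i ws) Y ×
        length X ≤ (2 * D) ^ k * length Y
    select zero P X pos U R perm bound = [] , R , map proj₁ X , [] , ↭-refl , refl ,
      ↭-reflexive (sym (++-identityʳ _)) , all X ,
      ≤-reflexive (trans (sym (length-map proj₁ X)) (sym (*-identityˡ _)))
      where
      all : ∀ X → All (λ i → P i []) (map proj₁ X)
      all [] = []
      all ((i , p) ∷ X) = p ∷ all X
    select (suc k) P X pos U R perm bound = extend R perm covered-R average-R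
      where
      c : Fin n → ℕ
      c u = ∑ X (λ i → covers k P i u)

      n≤covered : ∀ (i : Σ I λ i → Many (suc k) (P i)) → n ≤ 2 * D * ∑ R (covers k P i)
      n≤covered (_ , A , big , _) = linear n (2 * D * r) 0
        (+-mono-≤ (+-mono-≤ big big)
          (+-mono-≤ (≤-trans (*-monoʳ-≤ (2 * D) U≤) bound) (*-monoʳ-≤ (2 * D) (≤-reflexive size≡))))
        (identity n D (sizeOf A) (∑ U (λ u → ι (A u))) r)
        where
        r : ℕ
        r = ∑ R (λ u → ι (A u))
        U≤ : ∑ U (λ u → ι (A u)) ≤ length U + suc k
        U≤ = ≤-trans (∑-≤const U (λ u → ι≤1 (A u)))
          (≤-trans (≤-reflexive (*-identityʳ (length U))) (m≤m+n _ _))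
        size≡ : sizeOf A ≡ ∑ U (λ u → ι (A u)) + r
        size≡ = trans (sym (∑-↭ (λ u → ι (A u)) perm)) (∑-++ U R (λ u → ι (A u)))
        identity : ∀ n D s u r → n + (D * s + D * s + (n + 2 * D * (u + r))) + 0
                               ≡ 2 * D * r + (n + n + (2 * D * u + 2 * D * s))
        identity = solve-∀

      covered-R : length X * n ≤ 2 * D * ∑ R c
      covered-R = begin
        length X * n ≡⟨ sym (∑-const X n) ⟩
        ∑ X (λ _ → n) ≤⟨ ∑-mono X n≤covered ⟩
        ∑ X (λ i → 2 * D * ∑ R (covers k P i)) ≡⟨ ∑-*ˡ X (2 * D) _ ⟩
        2 * D * ∑ X (λ i → ∑ R (covers k P i)) ≡⟨ cong (2 * D *_) (∑-swap X R (covers k P)) ⟩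
        2 * D * ∑ R c ∎
        where open ≤-Reasoning

      average-R : length R * length X ≤ ∑ R (λ u → 2 * D * c u)
      average-R = begin
        length R * length X ≤⟨ *-monoˡ-≤ (length X) R≤n ⟩
        n * length X ≡⟨ *-comm n (length X) ⟩
        length X * n ≤⟨ covered-R ⟩
        2 * D * ∑ R c ≡⟨ sym (∑-*ˡ R (2 * D) c) ⟩
        ∑ R (λ u → 2 * D * c u) ∎
        where
        open ≤-Reasoning
        R≤n : length R ≤ n
        R≤n = ≤-trans (m≤n+m (length R) (length U)) (≤-reflexive
          (trans (sym (length-++ U)) (trans (↭-length perm) (length-allFin n))))

      Result : List (Fin n) → Set
      Result R = Σ (List (Fin n)) λ ws → Σ (List (Fin n)) λ R′ → Σ (List I) λ Y → Σ (List I) λ Z →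
        R ↭ ws ++ R′ × length ws ≡ suc k × map proj₁ X ↭ Y ++ Z × All (λ i → P i ws) Y ×
        length X ≤ (2 * D) ^ suc k * length Y

      step : ∀ {R} u R₁ → R ↭ u ∷ R₁ → U ++ R ↭ V → length X ≤ 2 * D * c u → Result R
      step {R} u R₁ R↭ perm m≤ =
        let Y₁ , Z₁ , p₁ , l₁ = restrict k P u X
            m≤′ = subst (λ l → length X ≤ 2 * D * l) (sym l₁) m≤
            ws , R′ , Y , Z , R₁↭ , l , p , all , size =
              select k (λ i us → P i (u ∷ us)) Y₁ (positive (length Y₁) m≤′)
                (u ∷ U) R₁
                (↭-trans (↭-sym (shift u U R₁)) (↭-trans (++⁺ˡ U (↭-sym R↭)) perm))
                (≤-trans (≤-reflexive (cong (2 * D *_) (sym (+-suc (length U) k)))) bound)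
        in u ∷ ws , R′ , Y , Z ++ Z₁ ,
          ↭-trans R↭ (prep u R₁↭) , cong suc l ,
          ↭-trans p₁ (↭-trans (++⁺ʳ Z₁ p) (↭-reflexive (++-assoc Y Z Z₁))) , all ,
          ≤-trans m≤′ (≤-trans (*-monoʳ-≤ (2 * D) size)
            (≤-reflexive (sym (*-assoc (2 * D) ((2 * D) ^ k) (length Y)))))
        where
        positive : ∀ y → length X ≤ 2 * D * y → 0 < y
        positive zero h = ⊥-elim (<⇒≱ pos (≤-trans h (≤-reflexive (*-zeroʳ (2 * D)))))
        positive (suc y) h = s≤s z≤n

      extend : ∀ R → U ++ R ↭ V → length X * n ≤ 2 * D * ∑ R c → length R * length X ≤ ∑ R (λ u → 2 * D * c u) → Result R
      -- An empty remainder covers no item, although `X` is nonempty and n is positive.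
      extend [] perm h _ = ⊥-elim (<⇒≱ (*-mono-≤ pos 0<n) (≤-trans h (≤-reflexive (*-zeroʳ (2 * D)))))
      extend (r ∷ R) perm _ h =
        let u , u∈ , m≤ = average r R (λ u → 2 * D * c u) (length X) h
            R₁ , R↭ = ∈-split u∈
        in step u R₁ R↭ perm m≤

  Triple : Set
  Triple = Fin n × Fin n × Fin n

  triples : List Triple
  triples = cartesianProduct V (cartesianProduct V V)

  length-triples : length triples ≡ n * (n * n)
  length-triples = trans (length-× V (cartesianProduct V V))
    (cong₂ _*_ (length-allFin n) (trans (length-× V V) (cong₂ _*_ (length-allFin n) (length-allFin n))))
    where
    length-× : ∀ {A B : Set} (xs : List A) (ys : List B) →
      length (cartesianProduct xs ys) ≡ length xs * length ys
    length-× [] ys = refl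
    length-× (x ∷ xs) ys = trans (length-++ (map (x ,_) ys)) (cong₂ _+_ (length-map (x ,_) ys) (length-× xs ys))

  module Layers (k : ℕ) (absorbers : ∀ t → Many k (Absorbs t)) (c : ℕ) (K : suc c ≡ (2 * D) ^ k) where

    -- A selected tuple absorbs at least a share 1/(c + 1) of the triples in `X`, and the next round
    -- treats the rest. After `j` rounds at most the fraction (c/(c + 1))^j is unserved. Tuples
    -- selected for other triples tile by themselves.
    layer : ∀ j X U R → U ++ R ↭ V → 2 * D * (length U + k * j) ≤ n →
      Σ (List (Fin n)) λ W → Σ (List (Fin n)) λ R′ → Σ (List Triple) λ Z →
        R ↭ W ++ R′ × length W ≤ k * j × Tileable W ×
        (∀ t → t ∈ X → Tileable (triVertices t ++ W) ⊎ t ∈ Z) ×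
        length Z * suc c ^ j ≤ length X * c ^ j
    layer zero X U R perm bound =
      [] , R , X , ↭-refl , z≤n , tileable-[] , (λ t t∈ → inj₂ t∈) , ≤-refl
    layer (suc j) [] U R perm bound =
      [] , R , [] , ↭-refl , z≤n , tileable-[] , (λ t ()) , z≤n
    layer (suc j) X@(_ ∷ _) U R perm bound =
      let items = map (λ t → t , absorbers t) X
          ws , R₁ , Y , Z₁ , R↭ , l , X↭ , all , size =
            select k Absorbs items (s≤s z≤n) U R perm
              (≤-trans (*-monoʳ-≤ (2 * D) (+-monoʳ-≤ (length U) (k≤ j))) bound)
          W , R′ , Z , R₁↭ , l′ , tW , cov , size′ =
            layer j Z₁ (U ++ ws) R₁
              (↭-trans (↭-reflexive (++-assoc U ws R₁)) (↭-trans (++⁺ˡ U (↭-sym R↭)) perm))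
              (≤-trans (≤-reflexive (cong (2 * D *_) (used ws l))) bound)
      in ws ++ W , R′ , Z ,
         ↭-trans R↭ (↭-trans (++⁺ˡ ws R₁↭) (↭-reflexive (sym (++-assoc ws W R′)))) ,
         ≤-trans (≤-reflexive (trans (length-++ ws) (cong (_+ length W) l)))
           (≤-trans (+-monoʳ-≤ k l′) (≤-reflexive (sym (*-suc k j)))) ,
         tileable-++ (tile-ws Y size all) tW ,
         (λ t t∈ → covered t (∈-++⁻ Y (∈-resp-↭ X↭ (subst (t ∈_) (sym (firsts X)) t∈))) all (tile-ws Y size all) tW (cov t)) ,
         shrink (length X) (length Y) (length Z₁) (length Z) (suc c ^ j) (c ^ j)
           (trans (trans (sym (cong length (firsts X))) (↭-length X↭)) (length-++ Y))
           (≤-trans (≤-trans (≤-reflexive (sym (length-map _ X))) size) (≤-reflexive (cong (_* length Y) (sym K))))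
           size′
      where
      k≤ : ∀ j → k ≤ k * suc j
      k≤ j = ≤-trans (m≤m+n k (k * j)) (≤-reflexive (sym (*-suc k j)))
      used : ∀ ws → length ws ≡ k → length (U ++ ws) + k * j ≡ length U + k * suc j
      used ws l = trans (cong (_+ k * j) (trans (length-++ U) (cong (length U +_) l)))
        (trans (+-assoc (length U) k (k * j)) (cong (length U +_) (sym (*-suc k j))))
      firsts : ∀ X → map proj₁ (map (λ t → t , absorbers t) X) ≡ X
      firsts [] = refl
      firsts (x ∷ X) = cong (x ∷_) (firsts X)
      -- The selected tuple serves at least one triple, as `X` is nonempty, and an absorber of any
      -- triple tiles by itself.
      tile-ws : ∀ {ws m} Y → suc m ≤ (2 * D) ^ k * length Y → All (λ t → Absorbs t ws) Y → Tileable ws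
      tile-ws [] h _ = ⊥-elim (<⇒≱ h (≤-trans (≤-reflexive (*-zeroʳ ((2 * D) ^ k))) z≤n))
      tile-ws (_ ∷ _) _ ((t , _) ∷ _) = t
      covered : ∀ t {ws W} {Y Z₁ Z : List Triple} → t ∈ Y ⊎ t ∈ Z₁ → All (λ t → Absorbs t ws) Y →
        Tileable ws → Tileable W → (t ∈ Z₁ → Tileable (triVertices t ++ W) ⊎ t ∈ Z) →
        Tileable (triVertices t ++ ws ++ W) ⊎ t ∈ Z
      covered t {ws} {W} (inj₁ t∈Y) all tws tW _ =
        inj₁ (tileable-++ (proj₂ (All.lookup all t∈Y)) tW)
      covered t {ws} {W} (inj₂ t∈Z₁) all tws tW f with f t∈Z₁
      ... | inj₂ t∈Z = inj₂ t∈Z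
      ... | inj₁ tile = inj₁ (tileable-↭ (regroup (triVertices t) ws W) (tileable-++ tile tws))
        where
        regroup : ∀ t ws W → (t ++ W) ++ ws ↭ t ++ (ws ++ W)
        regroup = bagSolve 3 (λ t ws W → (t ⊕ W) ⊕ ws ⊜ t ⊕ (ws ⊕ W)) ↭-refl
      shrink : ∀ x y z₁ z p q → x ≡ y + z₁ → x ≤ suc c * y → z * p ≤ z₁ * q →
        z * (suc c * p) ≤ x * (c * q)
      shrink x y z₁ z p q refl h h′ = begin
        z * (suc c * p) ≡⟨ e₁ z (suc c) p ⟩
        suc c * (z * p) ≤⟨ *-monoʳ-≤ (suc c) h′ ⟩
        suc c * (z₁ * q) ≡⟨ sym (*-assoc (suc c) z₁ q) ⟩
        suc c * z₁ * q ≤⟨ *-monoˡ-≤ q (linear (suc c * z₁) ((y + z₁) * c) 0 h (e₂ c y z₁)) ⟩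
        (y + z₁) * c * q ≡⟨ *-assoc (y + z₁) c q ⟩
        (y + z₁) * (c * q) ∎
        where
        open ≤-Reasoning
        e₁ : ∀ z k p → z * (k * p) ≡ k * (z * p)
        e₁ = solve-∀
        e₂ : ∀ c y z → suc c * z + suc c * y + 0 ≡ (y + z) * c + (y + z)
        e₂ = solve-∀

    -- Each of the `s` layers starts from all triples. By `few`, less than one triple stays
    -- unserved, so a layer absorbs any single triple; a layer with nothing to absorb tiles by
    -- itself.
    absorbing-set : ∀ s j → n * (n * n) * c ^ j < suc c ^ j → ∀ U R → U ++ R ↭ V →
      2 * D * (length U + k * j * s) ≤ n →
      Σ (List (Fin n)) λ W → Σ (List (Fin n)) λ R′ → R ↭ W ++ R′ × length W ≤ k * j * s ×
        (∀ r L → r ≤ s → length L ≡ r * 3 → Tileable (L ++ W))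
    absorbing-set zero j few U R perm bound = [] , R , ↭-refl , z≤n ,
      λ { zero [] _ _ → tileable-[] ; (suc r) _ () _ }
    absorbing-set (suc s) j few U R perm bound =
      let W₀ , R₁ , Z , R↭ , l , tW₀ , cov , size = layer j triples U R perm
            (≤-trans (*-monoʳ-≤ (2 * D) (+-monoʳ-≤ (length U) (≤-trans (m≤m+n (k * j) _) (≤-reflexive (sym (*-suc (k * j) s)))))) bound)
          W , R′ , R₁↭ , l′ , absorb = absorbing-set s j few (U ++ W₀) R₁
            (↭-trans (↭-reflexive (++-assoc U W₀ R₁)) (↭-trans (++⁺ˡ U (↭-sym R↭)) perm))
            (≤-trans (*-monoʳ-≤ (2 * D) (used W₀ l)) bound)
      in W₀ ++ W , R′ ,
         ↭-trans R↭ (↭-trans (++⁺ˡ W₀ R₁↭) (↭-reflexive (sym (++-assoc W₀ W R′)))) ,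
         ≤-trans (≤-reflexive (length-++ W₀)) (≤-trans (+-mono-≤ l l′) (≤-reflexive (sym (*-suc (k * j) s)))) ,
         absorb-more W₀ W tW₀ absorb
           (λ t → all-covered t Z size (cov t (∈-cartesianProduct⁺ (∈-allFin _) (∈-cartesianProduct⁺ (∈-allFin _) (∈-allFin _)))))
      where
      used : ∀ W₀ → length W₀ ≤ k * j → length (U ++ W₀) + k * j * s ≤ length U + k * j * suc s
      used W₀ l = ≤-trans (≤-reflexive (trans (cong (_+ k * j * s) (length-++ U)) (+-assoc (length U) _ _)))
        (+-monoʳ-≤ (length U) (≤-trans (+-monoˡ-≤ _ l) (≤-reflexive (sym (*-suc (k * j) s)))))
      all-covered : ∀ t {W} Z → length Z * suc c ^ j ≤ length triples * c ^ j →
        Tileable (triVertices t ++ W) ⊎ t ∈ Z → Tileable (triVertices t ++ W)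
      all-covered t Z size (inj₁ tile) = tile
      all-covered t (z ∷ Z) size (inj₂ _) = ⊥-elim (<⇒≱ few
        (≤-trans (m≤m+n (suc c ^ j) _) (≤-trans size (≤-reflexive (cong (_* c ^ j) length-triples)))))
      absorb-more : ∀ W₀ W → Tileable W₀ → (∀ r L → r ≤ s → length L ≡ r * 3 → Tileable (L ++ W)) →
        (∀ t → Tileable (triVertices t ++ W₀)) →
        ∀ r L → r ≤ suc s → length L ≡ r * 3 → Tileable (L ++ W₀ ++ W)
      absorb-more W₀ W t₀ f g zero [] _ _ = tileable-++ t₀ (f 0 [] z≤n refl)
      absorb-more W₀ W t₀ f g (suc r) (x ∷ y ∷ z ∷ L) (s≤s r≤s) l =
        tileable-↭ (regroup (x ∷ y ∷ z ∷ []) L W₀ W)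
          (tileable-++ (g (x , y , z)) (f r L r≤s (suc-injective (suc-injective (suc-injective l)))))
        where
        regroup : ∀ t L W₀ W → (t ++ W₀) ++ (L ++ W) ↭ t ++ (L ++ (W₀ ++ W))
        regroup = bagSolve 4 (λ t L W₀ W → (t ⊕ W₀) ⊕ (L ⊕ W) ⊜ t ⊕ (L ⊕ (W₀ ⊕ W))) ↭-refl

-- Searches in lists and choices among three vertices.

check₆ : (p : ℕ → ℕ → ℕ → ℕ → ℕ → ℕ → Bool) →
  T (∀≤2 λ a → ∀≤2 λ b → ∀≤2 λ c → ∀≤2 λ d → ∀≤2 λ e → ∀≤2 (p a b c d e)) →
  ∀ {a b c d e f} → a ≤ 2 → b ≤ 2 → c ≤ 2 → d ≤ 2 → e ≤ 2 → f ≤ 2 → T (p a b c d e f)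
check₆ p t {a} {b} ha hb = check₄ (p a b)
  (check₂ (λ a b → ∀≤2 λ c → ∀≤2 λ d → ∀≤2 λ e → ∀≤2 (p a b c d e)) t ha hb)

∨-elim : ∀ {a b} {X : Set} → (T a → X) → (T b → X) → T (a ∨ b) → X
∨-elim {true} f g t = f t
∨-elim {false} f g t = g t

concatMap-↭ : ∀ {A B : Set} (k : A → List B) {xs ys} → xs ↭ ys → concatMap k xs ↭ concatMap k ys
concatMap-↭ k ↭-done = ↭-refl
concatMap-↭ k (prep x p) = ++⁺ˡ (k x) (concatMap-↭ k p)
concatMap-↭ k (swap {xs} {ys} x y p) = ↭-trans (exchange (k x) (k y) (concatMap k xs))
  (++⁺ˡ (k y) (++⁺ˡ (k x) (concatMap-↭ k p)))
  where
  open ↭-Solver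
  exchange : ∀ a b c → a ++ (b ++ c) ↭ b ++ (a ++ c)
  exchange = bagSolve 3 (λ a b c → a ⊕ (b ⊕ c) ⊜ b ⊕ (a ⊕ c)) ↭-refl
concatMap-↭ k (↭-step p q) = ↭-trans (concatMap-↭ k p) (concatMap-↭ k q)

module _ {A : Set} where

  search : ∀ {P Q : A → Set} → (∀ x → P x ⊎ Q x) → ∀ xs →
    (∃ λ x → x ∈ xs × P x) ⊎ (∀ x → x ∈ xs → Q x)
  search f [] = inj₂ λ _ ()
  search {P} {Q} f (x ∷ xs) with f x | search {P} {Q} f xs
  ... | inj₁ p | _ = inj₁ (x , here refl , p)
  ... | inj₂ q | inj₁ (y , y∈ , p) = inj₁ (y , there y∈ , p)
  ... | inj₂ q | inj₂ g = inj₂ λ { _ (here refl) → q ; y (there y∈) → g y y∈ }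

  -- Irreflexivity excludes `y` equal to `x`, so `y` is still present after `x` has been split off.
  search-pair : ∀ {P Q : A → A → Set} → (∀ x y → P x y ⊎ Q x y) → (∀ x → ¬ P x x) → ∀ xs →
    (∃ λ x → ∃ λ y → ∃ λ zs → xs ↭ x ∷ y ∷ zs × P x y) ⊎ (∀ x y → x ∈ xs → y ∈ xs → Q x y)
  search-pair {P} {Q} f irr xs
    with search (λ x → search {P x} {Q x} (f x) xs) xs
  ... | inj₂ g = inj₂ λ x y x∈ → g x x∈ y
  ... | inj₁ (x , x∈ , y , y∈ , p) with ∈-split x∈
  ... | ys , xs↭ with ∈-resp-↭ xs↭ y∈
  ... | here refl = ⊥-elim (irr x p)
  ... | there y∈′ with ∈-split y∈′
  ... | zs , ys↭ = inj₁ (x , y , zs , ↭-trans xs↭ (prep x ys↭) , p)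

  -- If at most one entry has a value above `b`, it exceeds `b` by at most `c`, which is the whole
  -- additive error.
  two-large : ∀ (f : A → ℕ) b c → (∀ x → f x ≤ b + c) → ∀ xs →
    (∃ λ x → ∃ λ y → ∃ λ zs → xs ↭ x ∷ y ∷ zs × b < f x × b < f y) ⊎ (∑ xs f ≤ length xs * b + c)
  two-large f b c bound [] = inj₂ z≤n
  two-large f b c bound (x ∷ xs) with f x ≤? b
  ... | no fx≰b with search {λ y → b < f y} {λ y → f y ≤ b} (λ y → large? y) xs
    where
    large? : ∀ y → b < f y ⊎ f y ≤ b
    large? y with f y ≤? b
    ... | yes h = inj₂ h
    ... | no h = inj₁ (≰⇒> h)
  ... | inj₁ (y , y∈ , fy) = let zs , xs↭ = ∈-split y∈ in inj₁ (x , y , zs , prep x xs↭ , ≰⇒> fx≰b , fy)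
  ... | inj₂ g = inj₂ (≤-trans (+-mono-≤ (bound x) (≤-trans (∑-mono∈ xs g) (≤-reflexive (∑-const xs b))))
      (≤-reflexive (move b c (length xs * b))))
    where
    move : ∀ b c l → b + c + l ≡ b + l + c
    move = solve-∀
  two-large f b c bound (x ∷ xs) | yes fx≤b with two-large f b c bound xs
  ... | inj₁ (y , z , zs , xs↭ , hy , hz) = inj₁ (y , z , x ∷ zs ,
      ↭-trans (prep x xs↭) (↭-trans (swap x y ↭-refl) (prep y (swap x z ↭-refl))) , hy , hz)
  ... | inj₂ h = inj₂ (≤-trans (+-mono-≤ fx≤b h) (≤-reflexive (sym (+-assoc b (length xs * b) c))))

AtLeastTwo : {A : Set} → (A → Set) → A → A → A → Set
AtLeastTwo P a b c = (P a × P b) ⊎ (P a × P c) ⊎ (P b × P c)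

module _ {A : Set} {a b c : A} where
  private
    bac : b ∷ a ∷ c ∷ [] ↭ a ∷ b ∷ c ∷ []
    bac = swap b a ↭-refl
    acb : a ∷ c ∷ b ∷ [] ↭ a ∷ b ∷ c ∷ []
    acb = prep a (swap c b ↭-refl)
    cab : c ∷ a ∷ b ∷ [] ↭ a ∷ b ∷ c ∷ []
    cab = ↭-trans (swap c a ↭-refl) acb
    bca : b ∷ c ∷ a ∷ [] ↭ a ∷ b ∷ c ∷ []
    bca = ↭-trans (prep b (swap c a ↭-refl)) bac

  -- Two 2-subsets of a 3-set have distinct representatives; `w` is the element left over.
  distinct-choice : ∀ {P Q : A → Set} → AtLeastTwo P a b c → AtLeastTwo Q a b c →
    ∃ λ u → ∃ λ v → ∃ λ w → u ∷ v ∷ w ∷ [] ↭ a ∷ b ∷ c ∷ [] × P u × Q v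
  distinct-choice (inj₁ (pa , pb)) (inj₁ (qa , qb)) = a , b , c , ↭-refl , pa , qb
  distinct-choice (inj₁ (pa , pb)) (inj₂ (inj₁ (qa , qc))) = a , c , b , acb , pa , qc
  distinct-choice (inj₁ (pa , pb)) (inj₂ (inj₂ (qb , qc))) = a , b , c , ↭-refl , pa , qb
  distinct-choice (inj₂ (inj₁ (pa , pc))) (inj₁ (qa , qb)) = a , b , c , ↭-refl , pa , qb
  distinct-choice (inj₂ (inj₁ (pa , pc))) (inj₂ (inj₁ (qa , qc))) = a , c , b , acb , pa , qc
  distinct-choice (inj₂ (inj₁ (pa , pc))) (inj₂ (inj₂ (qb , qc))) = a , b , c , ↭-refl , pa , qb
  distinct-choice (inj₂ (inj₂ (pb , pc))) (inj₁ (qa , qb)) = b , a , c , bac , pb , qa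
  distinct-choice (inj₂ (inj₂ (pb , pc))) (inj₂ (inj₁ (qa , qc))) = b , a , c , bac , pb , qa
  distinct-choice (inj₂ (inj₂ (pb , pc))) (inj₂ (inj₂ (qb , qc))) = b , c , a , bca , pb , qc

  -- Two 2-subsets of a 3-set intersect. The other two elements are passed to `P` as well, since
  -- there they form a tile with a new vertex.
  common-choice : ∀ {P : A → A → A → Set} {Q : A → Set} →
    (P a b c × P b a c) ⊎ (P a b c × P c a b) ⊎ (P b a c × P c a b) → AtLeastTwo Q a b c →
    ∃ λ u → ∃ λ v → ∃ λ w → u ∷ v ∷ w ∷ [] ↭ a ∷ b ∷ c ∷ [] × P u v w × Q u
  common-choice (inj₁ (pa , pb)) (inj₁ (qa , qb)) = a , b , c , ↭-refl , pa , qa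
  common-choice (inj₁ (pa , pb)) (inj₂ (inj₁ (qa , qc))) = a , b , c , ↭-refl , pa , qa
  common-choice (inj₁ (pa , pb)) (inj₂ (inj₂ (qb , qc))) = b , a , c , bac , pb , qb
  common-choice (inj₂ (inj₁ (pa , pc))) (inj₁ (qa , qb)) = a , b , c , ↭-refl , pa , qa
  common-choice (inj₂ (inj₁ (pa , pc))) (inj₂ (inj₁ (qa , qc))) = a , b , c , ↭-refl , pa , qa
  common-choice (inj₂ (inj₁ (pa , pc))) (inj₂ (inj₂ (qb , qc))) = c , a , b , cab , pc , qc
  common-choice (inj₂ (inj₂ (pb , pc))) (inj₁ (qa , qb)) = b , a , c , bac , pb , qb
  common-choice (inj₂ (inj₂ (pb , pc))) (inj₂ (inj₁ (qa , qc))) = c , a , b , cab , pc , qc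
  common-choice (inj₂ (inj₂ (pb , pc))) (inj₂ (inj₂ (qb , qc))) = b , a , c , bac , pb , qb

-- With at most one value above `k` the sum could not exceed (k + l) + k + k.
at-least-two : ∀ {A : Set} (f : A → ℕ) k l → (∀ x → f x ≤ k + l) → ∀ a b c →
  (k + l) + k + k < f a + f b + f c → AtLeastTwo (λ x → k < f x) a b c
at-least-two f k l bound a b c h with f a ≤? k | f b ≤? k | f c ≤? k
... | no p | no q | _ = inj₁ (≰⇒> p , ≰⇒> q)
... | no p | yes q | no r = inj₂ (inj₁ (≰⇒> p , ≰⇒> r))
... | yes p | no q | no r = inj₂ (inj₂ (≰⇒> q , ≰⇒> r))
... | no p | yes q | yes r = ⊥-elim (<⇒≱ h (+-mono-≤ (+-mono-≤ (bound a) q) r))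
... | yes p | no q | yes r = ⊥-elim (<⇒≱ h (≤-trans (+-mono-≤ (+-mono-≤ p (bound b)) r) (≤-reflexive (cong (_+ k) (+-comm k (k + l))))))
... | yes p | yes q | no r = ⊥-elim (<⇒≱ h (≤-trans (+-mono-≤ (+-mono-≤ p q) (bound c)) (≤-reflexive (rot k l))))
  where
  rot : ∀ k l → k + k + (k + l) ≡ k + l + k + k
  rot = solve-∀
... | yes p | yes q | yes r = ⊥-elim (<⇒≱ h (+-mono-≤ (+-mono-≤ (≤-trans p (m≤m+n k l)) q) r))

-- Near tiling: local exchanges.

module NearTiling {n : ℕ} (M : Multigraph n) (std : Standard M) where

  open ↭-Solver {Fin n}

  private
    m : Fin n → Fin n → ℕ
    m = μ M

  Tile Pair : Set
  Tile = Fin n × Fin n × Fin n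
  Pair = Fin n × Fin n

  pairVertices : Pair → List (Fin n)
  pairVertices (p , q) = p ∷ q ∷ []

  Double : Pair → Set
  Double (p , q) = m p q ≡ 2

  weight : Pair → Fin n → ℕ
  weight (p , q) v = m p v + m q v

  five : ℕ → ℕ → ℕ → Bool
  five a b c = (1 ≤ᵇ a) ∧ (1 ≤ᵇ b) ∧ (1 ≤ᵇ c) ∧ (5 ≤ᵇ a + b + c)

  five-sound : ∀ x y z → T (five (m x y) (m y z) (m x z)) → FiveTriangle M (x , y , z)
  five-sound x y z t =
    let p , t = T∧ (1 ≤ᵇ m x y) t
        q , t = T∧ (1 ≤ᵇ m y z) t
        r , s = T∧ (1 ≤ᵇ m x z) t
    in ≤ᵇ⇒≤ 1 _ p , ≤ᵇ⇒≤ 1 _ q , ≤ᵇ⇒≤ 1 _ r , ≤ᵇ⇒≤ 5 _ s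

  five-complete : ∀ {x y z} → FiveTriangle M (x , y , z) → T (five (m x y) (m y z) (m x z))
  five-complete (p , q , r , s) = ∧-intro (≤⇒≤ᵇ p) (∧-intro (≤⇒≤ᵇ q) (∧-intro (≤⇒≤ᵇ r) (≤⇒≤ᵇ s)))
    where
    ∧-intro : ∀ {a b} → T a → T b → T (a ∧ b)
    ∧-intro {true} _ t = t

  -- Multiplicities are at most 2, so a vertex sending three edges to a double edge is adjacent to
  -- both of its ends.
  complete-double : ∀ {e} v → Double e → 2 < weight e v → FiveTriangle M (proj₁ e , proj₂ e , v)
  complete-double {p , q} v d h = five-sound p q v
    (modus (modus {2 ≤ᵇ m p q} (check₃ (λ a b c → (2 ≤ᵇ a) ⇒ᵇ (3 ≤ᵇ b + c) ⇒ᵇ five a c b) _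
      (std p q) (std p v) (std q v)) (≤⇒≤ᵇ (≤-reflexive (sym d)))) (≤⇒≤ᵇ h))

  -- Nine edges from a double edge to three vertices, at most four to each, put at least three on
  -- two of them. Distinct vertices of the tile then complete `e` and `f`, so one tile is traded for
  -- two.
  two-tiles : ∀ {e f} a b c → Double e → Double f →
    8 < ∑ (a ∷ b ∷ c ∷ []) (weight e) → 8 < ∑ (a ∷ b ∷ c ∷ []) (weight f) →
    ∃ λ u → ∃ λ v → ∃ λ w → u ∷ v ∷ w ∷ [] ↭ a ∷ b ∷ c ∷ [] ×
      FiveTriangle M (proj₁ e , proj₂ e , u) × FiveTriangle M (proj₁ f , proj₂ f , v)
  two-tiles {e} {f} a b c de df he hf =
    let u , v , w , p , hu , hv = distinct-choice {P = λ v → 2 < weight e v} {Q = λ v → 2 < weight f v} (heavy e he) (heavy f hf)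
    in u , v , w , p , complete-double u de hu , complete-double v df hv
    where
    heavy : ∀ e → 8 < ∑ (a ∷ b ∷ c ∷ []) (weight e) → AtLeastTwo (λ v → 2 < weight e v) a b c
    heavy e@(p , q) h = at-least-two (weight e) 2 2 (λ v → +-mono-≤ (std p v) (std q v)) a b c
      (≤-trans h (≤-reflexive (assoc (weight e a) (weight e b) (weight e c))))
      where
      assoc : ∀ x y z → x + (y + (z + 0)) ≡ x + y + z
      assoc = solve-∀

  -- If `x` and `y` each send five edges to a tile, then `x` can replace at least two of its
  -- vertices and `y` has double edges to at least two. At a common vertex `u`, `x` takes its place
  -- and `y u` becomes a double edge.
  swap-in : ∀ x y a b c → FiveTriangle M (a , b , c) →
    4 < ∑ (a ∷ b ∷ c ∷ []) (m x) → 4 < ∑ (a ∷ b ∷ c ∷ []) (m y) →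
    ∃ λ u → ∃ λ v → ∃ λ w → u ∷ v ∷ w ∷ [] ↭ a ∷ b ∷ c ∷ [] ×
      FiveTriangle M (x , v , w) × m y u ≡ 2
  swap-in x y a b c tri hx hy = common-choice {P = λ _ v w → FiveTriangle M (x , v , w)} {Q = λ u → m y u ≡ 2}
    (∨-elim (λ t → let f , g = T∧ fa t in inj₁ (five-sound x b c f , five-sound x a c g))
      (∨-elim (λ t → let f , g = T∧ fa t in inj₂ (inj₁ (five-sound x b c f , five-sound x a b g)))
              (λ t → let f , g = T∧ fb t in inj₂ (inj₂ (five-sound x a c f , five-sound x a b g))))
      frees)
    doubles
    where
    assoc : ∀ x y z → x + (y + (z + 0)) ≡ x + y + z
    assoc = solve-∀
    fa fb fc : Bool
    fa = five (m x b) (m b c) (m x c)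
    fb = five (m x a) (m a c) (m x c)
    fc = five (m x a) (m a b) (m x b)
    frees : T ((fa ∧ fb) ∨ (fa ∧ fc) ∨ (fb ∧ fc))
    frees = modus (modus {5 ≤ᵇ m x a + m x b + m x c}
      (check₆ (λ xa xb xc ab bc ac → (5 ≤ᵇ xa + xb + xc) ⇒ᵇ five ab bc ac ⇒ᵇ
          ((five xb bc xc ∧ five xa ac xc) ∨ (five xb bc xc ∧ five xa ab xb) ∨ (five xa ac xc ∧ five xa ab xb)))
        _ (std x a) (std x b) (std x c) (std a b) (std b c) (std a c))
      (≤⇒≤ᵇ (≤-trans hx (≤-reflexive (assoc (m x a) (m x b) (m x c)))))) (five-complete tri)
    doubles : AtLeastTwo (λ u → m y u ≡ 2) a b c
    doubles with at-least-two (m y) 1 1 (std y) a b c (≤-trans hy (≤-reflexive (assoc (m y a) (m y b) (m y c))))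
    ... | inj₁ (p , q) = inj₁ (≤-antisym (std y a) p , ≤-antisym (std y b) q)
    ... | inj₂ (inj₁ (p , q)) = inj₂ (inj₁ (≤-antisym (std y a) p , ≤-antisym (std y c) q))
    ... | inj₂ (inj₂ (p , q)) = inj₂ (inj₂ (≤-antisym (std y b) p , ≤-antisym (std y c) q))

  record Tiling (xs : List (Fin n)) : Set where
    constructor tiling
    field
      tiles   : List Tile
      pairs   : List Pair
      singles : List (Fin n)
      cover   : concatMap triVertices tiles ++ concatMap pairVertices pairs ++ singles ↭ xs
      tile    : ∀ t → t ∈ tiles → FiveTriangle M t
      double  : ∀ e → e ∈ pairs → Double e

    uncovered : List (Fin n)
    uncovered = concatMap pairVertices pairs ++ singles

    -- A tile outweighs two double edges, so exchanges that spend two double edges on one additional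
    -- tile are gains too.
    potential : ℕ
    potential = length tiles * 3 + length pairs

  open Tiling

  Better : ∀ {xs} → Tiling xs → Set
  Better {xs} S = Σ (Tiling xs) λ S′ → potential S < potential S′

  all-∷ : ∀ {A : Set} {P : A → Set} {x xs} → P x → (∀ y → y ∈ xs → P y) → ∀ y → y ∈ x ∷ xs → P y
  all-∷ p f _ (here refl) = p
  all-∷ p f y (there y∈) = f y y∈

  private
    T⁺ : List Tile → List (Fin n)
    T⁺ = concatMap triVertices
    P⁺ : List Pair → List (Fin n)
    P⁺ = concatMap pairVertices

  -- The additive 4 and 2 allow for the one double edge, respectively single, that may send more
  -- than 8, respectively 4, edges to a given tile.
  Saturated : ∀ {xs} → Tiling xs → Set
  Saturated S =
    (∀ x y → x ∈ singles S → y ∈ singles S → m x y ≤ 1) ×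
    (∀ e v → e ∈ pairs S → v ∈ uncovered S → weight e v ≤ 2) ×
    (∀ t → t ∈ tiles S → ∑ (pairs S) (λ e → ∑ (triVertices t) (weight e)) ≤ length (pairs S) * 8 + 4) ×
    (∀ t → t ∈ tiles S → ∑ (singles S) (λ x → ∑ (triVertices t) (m x)) ≤ length (singles S) * 4 + 2)

  small? : ∀ b k → b < k ⊎ k ≤ b
  small? b k with k ≤? b
  ... | yes h = inj₂ h
  ... | no h = inj₁ (≰⇒> h)

  module _ {xs : List (Fin n)} where

    add-pair : ∀ (S : Tiling xs) {x y zs} → singles S ↭ x ∷ y ∷ zs → 1 < m x y → Better S
    add-pair (tiling ts ps is c t d) {x} {y} {zs} is↭ h =
      tiling ts ((x , y) ∷ ps) zs
        (↭-trans (eq (T⁺ ts) (P⁺ ps) [ x ] [ y ] zs)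
          (↭-trans (++⁺ˡ (T⁺ ts) (++⁺ˡ (P⁺ ps) (↭-sym is↭))) c))
        t (all-∷ (≤-antisym (std x y) h) d) ,
      ≤-reflexive (sym (+-suc (length ts * 3) (length ps)))
      where
      eq : ∀ T P x y z → T ++ ((x ++ y ++ P) ++ z) ↭ T ++ (P ++ (x ++ y ++ z))
      eq = bagSolve 5 (λ T P x y z → T ⊕ ((x ⊕ (y ⊕ P)) ⊕ z) ⊜ T ⊕ (P ⊕ (x ⊕ (y ⊕ z)))) ↭-refl

    pair-single : ∀ (S : Tiling xs) {e z ps′ zs} → pairs S ↭ e ∷ ps′ → singles S ↭ z ∷ zs →
      2 < weight e z → Better S
    pair-single (tiling ts ps is c t d) {e@(p , q)} {z} {ps′} {zs} ps↭ is↭ h =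
      tiling ((p , q , z) ∷ ts) ps′ zs
        (↭-trans (eq [ p ] [ q ] [ z ] (T⁺ ts) (P⁺ ps′) zs)
          (↭-trans (++⁺ˡ (T⁺ ts) (++⁺ (concatMap-↭ pairVertices (↭-sym ps↭)) (↭-sym is↭))) c))
        (all-∷ (complete-double z (d e (∈-resp-↭ (↭-sym ps↭) (here refl))) h) t)
        (λ f f∈ → d f (∈-resp-↭ (↭-sym ps↭) (there f∈))) ,
      gain (length ts * 3) (↭-length ps↭)
      where
      eq : ∀ p q z T P r → (p ++ q ++ z ++ T) ++ (P ++ r) ↭ T ++ ((p ++ q ++ P) ++ (z ++ r))
      eq = bagSolve 6 (λ p q z T P r → (p ⊕ (q ⊕ (z ⊕ T))) ⊕ (P ⊕ r) ⊜ T ⊕ ((p ⊕ (q ⊕ P)) ⊕ (z ⊕ r))) ↭-refl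
      gain : ∀ t {k k′} → k ≡ suc k′ → t + k < 3 + t + k′
      gain t {k′ = k′} refl = ≤-trans (n≤1+n _) (≤-reflexive (arith t k′))
        where
        arith : ∀ t k′ → 2 + (t + suc k′) ≡ 3 + t + k′
        arith = solve-∀

    pair-pair : ∀ (S : Tiling xs) {e f ps′} → pairs S ↭ e ∷ f ∷ ps′ →
      (2 < weight e (proj₁ f)) ⊎ (2 < weight e (proj₂ f)) → Better S
    pair-pair (tiling ts ps is c t d) {e@(p , q)} {f@(r , s)} {ps′} ps↭ h = build h
      where
      gain : ∀ t {k k′} → k ≡ suc (suc k′) → t + k < 3 + t + k′
      gain t {k′ = k′} refl = ≤-reflexive (arith t k′)
        where
        arith : ∀ t k′ → 1 + (t + suc (suc k′)) ≡ 3 + t + k′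
        arith = solve-∀
      back : T⁺ ts ++ (P⁺ (e ∷ f ∷ ps′) ++ is) ↭ xs
      back = ↭-trans (++⁺ˡ (T⁺ ts) (++⁺ʳ is (concatMap-↭ pairVertices (↭-sym ps↭)))) c
      de : Double e
      de = d e (∈-resp-↭ (↭-sym ps↭) (here refl))
      d′ : ∀ g → g ∈ ps′ → Double g
      d′ g g∈ = d g (∈-resp-↭ (↭-sym ps↭) (there (there g∈)))
      eq₁ : ∀ p q r s T P i → (p ++ q ++ r ++ T) ++ (P ++ (s ++ i)) ↭ T ++ ((p ++ q ++ r ++ s ++ P) ++ i)
      eq₁ = bagSolve 7 (λ p q r s T P i → (p ⊕ (q ⊕ (r ⊕ T))) ⊕ (P ⊕ (s ⊕ i)) ⊜ T ⊕ ((p ⊕ (q ⊕ (r ⊕ (s ⊕ P)))) ⊕ i)) ↭-refl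
      eq₂ : ∀ p q r s T P i → (p ++ q ++ s ++ T) ++ (P ++ (r ++ i)) ↭ T ++ ((p ++ q ++ r ++ s ++ P) ++ i)
      eq₂ = bagSolve 7 (λ p q r s T P i → (p ⊕ (q ⊕ (s ⊕ T))) ⊕ (P ⊕ (r ⊕ i)) ⊜ T ⊕ ((p ⊕ (q ⊕ (r ⊕ (s ⊕ P)))) ⊕ i)) ↭-refl
      build : (2 < weight e r) ⊎ (2 < weight e s) → Better (tiling ts ps is c t d)
      build (inj₁ h) = tiling ((p , q , r) ∷ ts) ps′ (s ∷ is)
        (↭-trans (eq₁ [ p ] [ q ] [ r ] [ s ] (T⁺ ts) (P⁺ ps′) is) back)
        (all-∷ (complete-double r de h) t) d′ , gain (length ts * 3) (↭-length ps↭)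
      build (inj₂ h) = tiling ((p , q , s) ∷ ts) ps′ (r ∷ is)
        (↭-trans (eq₂ [ p ] [ q ] [ r ] [ s ] (T⁺ ts) (P⁺ ps′) is) back)
        (all-∷ (complete-double s de h) t) d′ , gain (length ts * 3) (↭-length ps↭)

    pairs-tile : ∀ (S : Tiling xs) {t e f ps′} → t ∈ tiles S → pairs S ↭ e ∷ f ∷ ps′ →
      8 < ∑ (triVertices t) (weight e) → 8 < ∑ (triVertices t) (weight f) → Better S
    pairs-tile (tiling ts ps is cov tl d) {a , b , c} {e@(p , q)} {f@(r , s)} {ps′} t∈ ps↭ he hf =
      let ts′ , ts↭ = ∈-split t∈
          u , v , w , uvw↭ , te , tf = two-tiles {e} {f} a b c (d e (∈-resp-↭ (↭-sym ps↭) (here refl)))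
            (d f (∈-resp-↭ (↭-sym ps↭) (there (here refl)))) he hf
      in tiling ((p , q , u) ∷ (r , s , v) ∷ ts′) ps′ (w ∷ is)
           (↭-trans (eq [ p ] [ q ] [ r ] [ s ] [ u ] [ v ] [ w ] (T⁺ ts′) (P⁺ ps′) is)
             (↭-trans (++⁺ (++⁺ʳ (T⁺ ts′) uvw↭) ↭-refl)
             (↭-trans (++⁺ (concatMap-↭ triVertices (↭-sym ts↭)) (++⁺ʳ is (concatMap-↭ pairVertices (↭-sym ps↭)))) cov)))
           (all-∷ te (all-∷ tf (λ g g∈ → tl g (∈-resp-↭ (↭-sym ts↭) (there g∈)))))
           (λ g g∈ → d g (∈-resp-↭ (↭-sym ps↭) (there (there g∈)))) ,
         gain (↭-length ts↭) (↭-length ps↭)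
      where
      eq : ∀ p q r s u v w T P i → (p ++ q ++ u ++ r ++ s ++ v ++ T) ++ (P ++ (w ++ i)) ↭
                                   ((u ++ v ++ w) ++ T) ++ ((p ++ q ++ r ++ s ++ P) ++ i)
      eq = bagSolve 10 (λ p q r s u v w T P i →
        (p ⊕ (q ⊕ (u ⊕ (r ⊕ (s ⊕ (v ⊕ T)))))) ⊕ (P ⊕ (w ⊕ i)) ⊜
        ((u ⊕ (v ⊕ w)) ⊕ T) ⊕ ((p ⊕ (q ⊕ (r ⊕ (s ⊕ P)))) ⊕ i)) ↭-refl
      gain : ∀ {t t′ k k′} → t ≡ suc t′ → k ≡ suc (suc k′) → t * 3 + k < suc (suc t′) * 3 + k′
      gain {t′ = t′} {k′ = k′} refl refl = ≤-reflexive (arith (t′ * 3) k′)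
        where
        arith : ∀ t k′ → 1 + (3 + t + suc (suc k′)) ≡ 6 + t + k′
        arith = solve-∀

    singles-tile : ∀ (S : Tiling xs) {t x y zs} → t ∈ tiles S → singles S ↭ x ∷ y ∷ zs →
      4 < ∑ (triVertices t) (m x) → 4 < ∑ (triVertices t) (m y) → Better S
    singles-tile (tiling ts ps is cov tl d) {a , b , c} {x} {y} {zs} t∈ is↭ hx hy =
      let ts′ , ts↭ = ∈-split t∈
          u , v , w , uvw↭ , tx , dy = swap-in x y a b c (tl _ t∈) hx hy
      in tiling ((x , v , w) ∷ ts′) ((y , u) ∷ ps) zs
           (↭-trans (eq [ x ] [ y ] [ u ] [ v ] [ w ] (T⁺ ts′) (P⁺ ps) zs)
             (↭-trans (++⁺ (++⁺ʳ (T⁺ ts′) uvw↭) ↭-refl)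
             (↭-trans (++⁺ (concatMap-↭ triVertices (↭-sym ts↭)) (++⁺ˡ (P⁺ ps) (↭-sym is↭))) cov)))
           (all-∷ tx (λ g g∈ → tl g (∈-resp-↭ (↭-sym ts↭) (there g∈))))
           (all-∷ dy d) ,
         gain (↭-length ts↭)
      where
      eq : ∀ x y u v w T P i → (x ++ v ++ w ++ T) ++ ((y ++ u ++ P) ++ i) ↭
                               ((u ++ v ++ w) ++ T) ++ (P ++ (x ++ y ++ i))
      eq = bagSolve 8 (λ x y u v w T P i →
        (x ⊕ (v ⊕ (w ⊕ T))) ⊕ ((y ⊕ (u ⊕ P)) ⊕ i) ⊜ ((u ⊕ (v ⊕ w)) ⊕ T) ⊕ (P ⊕ (x ⊕ (y ⊕ i)))) ↭-refl
      gain : ∀ {t t′} → t ≡ suc t′ → t * 3 + length ps < suc t′ * 3 + suc (length ps)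
      gain {t′ = t′} refl = ≤-reflexive (sym (+-suc (suc t′ * 3) (length ps)))

    -- Each exchange is searched for in turn, and the failed searches yield the clauses of
    -- `Saturated`. The second clause merges the searches at singles and at other double edges.
    improve : ∀ (S : Tiling xs) → Better S ⊎ Saturated S
    improve S
      with search-pair {P = λ x y → 1 < m x y} {Q = λ x y → m x y ≤ 1} (λ x y → small? 1 (m x y))
             (λ x h → <⇒≱ h (≤-trans (≤-reflexive (loopless M x)) z≤n)) (singles S)
    ... | inj₁ (x , y , zs , is↭ , h) = inj₁ (add-pair S is↭ h)
    ... | inj₂ single
      with search {P = λ e → ∃ λ z → z ∈ singles S × 2 < weight e z} {Q = λ e → ∀ z → z ∈ singles S → weight e z ≤ 2}
             (λ e → search (λ z → small? 2 (weight e z)) (singles S)) (pairs S)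
    ... | inj₁ (e , e∈ , z , z∈ , h) = inj₁ (pair-single S (proj₂ (∈-split e∈)) (proj₂ (∈-split z∈)) h)
    ... | inj₂ light
      with search-pair {P = λ e f → (2 < weight e (proj₁ f)) ⊎ (2 < weight e (proj₂ f))}
             {Q = λ e f → weight e (proj₁ f) ≤ 2 × weight e (proj₂ f) ≤ 2} heavy? irr (pairs S)
      where
      heavy? : ∀ e f → ((2 < weight e (proj₁ f)) ⊎ (2 < weight e (proj₂ f))) ⊎
                       (weight e (proj₁ f) ≤ 2 × weight e (proj₂ f) ≤ 2)
      heavy? e (r , s) with small? 2 (weight e r) | small? 2 (weight e s)
      ... | inj₁ h | _ = inj₁ (inj₁ h)
      ... | inj₂ _ | inj₁ h = inj₁ (inj₂ h)
      ... | inj₂ g | inj₂ h = inj₂ (g , h)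
      -- By looplessness an end of a double edge sends at most 2 edges to that double edge.
      irr : ∀ e → ¬ ((2 < weight e (proj₁ e)) ⊎ (2 < weight e (proj₂ e)))
      irr (p , q) (inj₁ h) = <⇒≱ h (≤-trans (+-monoˡ-≤ _ (≤-reflexive (loopless M p))) (std q p))
      irr (p , q) (inj₂ h) = <⇒≱ h (≤-trans (+-mono-≤ (std p q) (≤-reflexive (loopless M q))) (≤-reflexive refl))
    ... | inj₁ (e , f , ps′ , ps↭ , h) = inj₁ (pair-pair S ps↭ h)
    ... | inj₂ light′
      with search {P = λ t → ∃ λ e → ∃ λ f → ∃ λ ps′ → pairs S ↭ e ∷ f ∷ ps′ ×
                      8 < ∑ (triVertices t) (weight e) × 8 < ∑ (triVertices t) (weight f)}
             {Q = λ t → ∑ (pairs S) (λ e → ∑ (triVertices t) (weight e)) ≤ length (pairs S) * 8 + 4}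
             (λ t → two-large (λ e → ∑ (triVertices t) (weight e)) 8 4
               (λ e → ∑-≤const (triVertices t) (λ v → +-mono-≤ (std (proj₁ e) v) (std (proj₂ e) v))) (pairs S)) (tiles S)
    ... | inj₁ (t , t∈ , e , f , ps′ , ps↭ , he , hf) = inj₁ (pairs-tile S t∈ ps↭ he hf)
    ... | inj₂ pairs-light
      with search {P = λ t → ∃ λ x → ∃ λ y → ∃ λ zs → singles S ↭ x ∷ y ∷ zs ×
                      4 < ∑ (triVertices t) (m x) × 4 < ∑ (triVertices t) (m y)}
             {Q = λ t → ∑ (singles S) (λ x → ∑ (triVertices t) (m x)) ≤ length (singles S) * 4 + 2}
             (λ t → two-large (λ x → ∑ (triVertices t) (m x)) 4 2
               (λ x → ∑-≤const (triVertices t) (std x)) (singles S)) (tiles S)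
    ... | inj₁ (t , t∈ , x , y , zs , is↭ , hx , hy) = inj₁ (singles-tile S t∈ is↭ hx hy)
    ... | inj₂ singles-light = inj₂ (single , light-all , pairs-light , singles-light)
      where
      light-pairs : ∀ e v ps → (∀ f → f ∈ ps → weight e (proj₁ f) ≤ 2 × weight e (proj₂ f) ≤ 2) →
        v ∈ P⁺ ps → weight e v ≤ 2
      light-pairs e v (f ∷ ps) g (here refl) = proj₁ (g f (here refl))
      light-pairs e v (f ∷ ps) g (there (here refl)) = proj₂ (g f (here refl))
      light-pairs e v (f ∷ ps) g (there (there v∈)) = light-pairs e v ps (λ f f∈ → g f (there f∈)) v∈
      light-all : ∀ e v → e ∈ pairs S → v ∈ uncovered S → weight e v ≤ 2
      light-all e v e∈ v∈ with ∈-++⁻ (P⁺ (pairs S)) v∈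
      ... | inj₁ v∈P = light-pairs e v (pairs S) (λ f f∈ → light′ e f e∈ f∈) v∈P
      ... | inj₂ v∈I = light e e∈ v v∈I

    length-split : ∀ (S : Tiling xs) → length xs ≡ length (tiles S) * 3 + length (uncovered S)
    length-split S = trans (sym (↭-length (cover S))) (trans (length-++ (T⁺ (tiles S)))
      (cong (_+ length (uncovered S)) (length-tiles (tiles S))))
      where
      length-tiles : ∀ ts → length (T⁺ ts) ≡ length ts * 3
      length-tiles [] = refl
      length-tiles (t ∷ ts) = cong (3 +_) (length-tiles ts)

    length-uncovered : ∀ (S : Tiling xs) → length (uncovered S) ≡ length (pairs S) * 2 + length (singles S)
    length-uncovered S = trans (length-++ (P⁺ (pairs S))) (cong (_+ length (singles S)) (length-pairs (pairs S)))
      where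
      length-pairs : ∀ ps → length (P⁺ ps) ≡ length ps * 2
      length-pairs [] = refl
      length-pairs (p ∷ ps) = cong (2 +_) (length-pairs ps)

    potential≤ : ∀ (S : Tiling xs) → potential S ≤ length xs
    potential≤ S = ≤-trans (+-monoʳ-≤ (length (tiles S) * 3)
        (≤-trans (m≤m*n (length (pairs S)) 2) (≤-trans (m≤m+n _ _) (≤-reflexive (sym (length-uncovered S))))))
      (≤-reflexive (sym (length-split S)))

    -- The potential never exceeds the number of vertices and grows with every exchange, so the fuel
    -- cannot run out.
    saturate : ∀ fuel (S : Tiling xs) → length xs < potential S + fuel → Σ (Tiling xs) Saturated
    saturate zero S h = ⊥-elim (<⇒≱ h (≤-trans (≤-reflexive (+-identityʳ _)) (potential≤ S)))
    saturate (suc fuel) S h with improve S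
    ... | inj₂ sat = S , sat
    ... | inj₁ (S′ , better) = saturate fuel S′
      (≤-trans h (≤-trans (≤-reflexive (+-suc (potential S) fuel)) (+-monoˡ-≤ fuel better)))

    saturated-tiling : Σ (Tiling xs) Saturated
    saturated-tiling = saturate (suc (length xs)) (tiling [] [] xs ↭-refl (λ _ ()) (λ _ ())) ≤-refl

  -- Double counting: few vertices stay uncovered.

  double-count : ∀ {A : Set} (as : List A) (ts : List Tile) (g : A → Tile → ℕ) k .{{_ : NonZero k}} c h u →
    (∀ a → a ∈ as → k * (c * (4 * (length ts * 3 + u)) + h) ≤ c * (3 * (∑ ts (g a) + k * u))) →
    (∀ t → t ∈ ts → ∑ as (λ a → g a t) ≤ length as * (4 * k) + 2 * k) →
    length as * h ≤ 6 * c * length ts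
  double-count as ts g k c h u lower upper = *-cancelˡ-≤ k
    (linear (k * (l * h)) (k * (6 * c * t)) (l * k * c * u) (+-mono-≤ L≤ (*-monoʳ-≤ (c * 3) G≤)) (identity l k c t u h G))
    where
    l t G : ℕ
    l = length as
    t = length ts
    G = ∑ as (λ a → ∑ ts (g a))
    L≤ : l * (k * (c * (4 * (t * 3 + u)) + h)) ≤ c * (3 * (G + l * (k * u)))
    L≤ = begin
      l * (k * (c * (4 * (t * 3 + u)) + h)) ≡⟨ sym (∑-const as _) ⟩
      ∑ as (λ _ → k * (c * (4 * (t * 3 + u)) + h)) ≤⟨ ∑-mono∈ as lower ⟩
      ∑ as (λ a → c * (3 * (∑ ts (g a) + k * u))) ≡⟨ ∑-*ˡ as c _ ⟩
      c * ∑ as (λ a → 3 * (∑ ts (g a) + k * u)) ≡⟨ cong (c *_) (∑-*ˡ as 3 _) ⟩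
      c * (3 * ∑ as (λ a → ∑ ts (g a) + k * u)) ≡⟨ cong (λ z → c * (3 * z)) (trans (∑-+ as _ _) (cong (G +_) (∑-const as (k * u)))) ⟩
      c * (3 * (G + l * (k * u))) ∎
      where open ≤-Reasoning
    G≤ : G ≤ t * (l * (4 * k) + 2 * k)
    G≤ = begin
      G ≡⟨ ∑-swap as ts g ⟩
      ∑ ts (λ s → ∑ as (λ a → g a s)) ≤⟨ ∑-mono∈ ts upper ⟩
      ∑ ts (λ _ → l * (4 * k) + 2 * k) ≡⟨ ∑-const ts _ ⟩
      t * (l * (4 * k) + 2 * k) ∎
      where open ≤-Reasoning
    identity : ∀ l k c t u h G →
      k * (l * h) + (c * (3 * (G + l * (k * u))) + c * 3 * (t * (l * (4 * k) + 2 * k))) + l * k * c * u ≡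
      k * (6 * c * t) + (l * (k * (c * (4 * (t * 3 + u)) + h)) + c * 3 * G)
    identity = solve-∀

  module _ {xs : List (Fin n)} (c h : ℕ)
    (degrees : ∀ x → x ∈ xs → c * (4 * length xs) + h ≤ c * (3 * ∑ xs (m x))) where

    -- Double edges and singles each number at most 6ct/h by `double-count`, with k = 2 and k = 1
    -- vertices per object: the main terms 4k per tile cancel, and the excess h is paid from the
    -- slack 2k per tile. Counting vertices triples 6ct, and 3t is at most the length of `xs`.
    few-uncovered : ∀ (S : Tiling xs) → Saturated S → length (uncovered S) * h ≤ 6 * c * length xs
    few-uncovered S (single , light , pairs-light , singles-light) = begin
      u * h ≡⟨ cong (_* h) (length-uncovered S) ⟩
      (length ps * 2 + length is) * h ≡⟨ expand (length ps) (length is) h ⟩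
      length ps * h + length ps * h + length is * h ≤⟨ +-mono-≤ (+-mono-≤ few-pairs few-pairs) few-singles ⟩
      6 * c * t + 6 * c * t + 6 * c * t ≡⟨ collect c t ⟩
      6 * c * (t * 3) ≤⟨ *-monoʳ-≤ (6 * c) (≤-trans (m≤m+n (t * 3) u) (≤-reflexive (sym (length-split S)))) ⟩
      6 * c * length xs ∎
      where
      open ≤-Reasoning
      ts = tiles S
      ps = pairs S
      is = singles S
      t u : ℕ
      t = length ts
      u = length (uncovered S)
      expand : ∀ p i h → (p * 2 + i) * h ≡ p * h + p * h + i * h
      expand = solve-∀
      collect : ∀ c t → 6 * c * t + 6 * c * t + 6 * c * t ≡ 6 * c * (t * 3)
      collect = solve-∀

      split : ∀ (f : Fin n → ℕ) → ∑ xs f ≡ ∑ ts (λ t → ∑ (triVertices t) f) + ∑ (uncovered S) f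
      split f = trans (sym (∑-↭ f (cover S))) (trans (∑-++ (T⁺ ts) (uncovered S) f)
        (cong (_+ ∑ (uncovered S) f) (∑-concatMap triVertices ts f)))

      ∈xs-pairs : ∀ e → e ∈ ps → proj₁ e ∈ xs × proj₂ e ∈ xs
      ∈xs-pairs e e∈ = let ps′ , ps↭ = ∈-split e∈
                           back = ↭-trans (++⁺ˡ (T⁺ ts) (++⁺ʳ is (concatMap-↭ pairVertices (↭-sym ps↭)))) (cover S)
                       in ∈-resp-↭ back (∈-++⁺ʳ (T⁺ ts) (here refl)) , ∈-resp-↭ back (∈-++⁺ʳ (T⁺ ts) (there (here refl)))

      few-pairs : length ps * h ≤ 6 * c * t
      few-pairs = double-count ps ts (λ e t → ∑ (triVertices t) (weight e)) 2 c h u lower pairs-light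
        where
        lower : ∀ e → e ∈ ps → 2 * (c * (4 * (t * 3 + u)) + h) ≤ c * (3 * (∑ ts (λ t → ∑ (triVertices t) (weight e)) + 2 * u))
        lower e e∈ = begin
          2 * (c * (4 * (t * 3 + u)) + h) ≡⟨ cong (λ z → 2 * (c * (4 * z) + h)) (sym (length-split S)) ⟩
          2 * (c * (4 * length xs) + h) ≡⟨ double≡ (c * (4 * length xs) + h) ⟩
          (c * (4 * length xs) + h) + (c * (4 * length xs) + h)
            ≤⟨ +-mono-≤ (degrees _ (proj₁ (∈xs-pairs e e∈))) (degrees _ (proj₂ (∈xs-pairs e e∈))) ⟩
          c * (3 * ∑ xs (m (proj₁ e))) + c * (3 * ∑ xs (m (proj₂ e))) ≡⟨ merge c (∑ xs (m (proj₁ e))) (∑ xs (m (proj₂ e))) ⟩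
          c * (3 * (∑ xs (m (proj₁ e)) + ∑ xs (m (proj₂ e)))) ≡⟨ cong (λ z → c * (3 * z)) (sym (∑-+ xs _ _)) ⟩
          c * (3 * ∑ xs (weight e)) ≡⟨ cong (λ z → c * (3 * z)) (split (weight e)) ⟩
          c * (3 * (∑ ts (λ t → ∑ (triVertices t) (weight e)) + ∑ (uncovered S) (weight e)))
            ≤⟨ *-monoʳ-≤ c (*-monoʳ-≤ 3 (+-monoʳ-≤ (∑ ts (λ t → ∑ (triVertices t) (weight e))) rest)) ⟩
          c * (3 * (∑ ts (λ t → ∑ (triVertices t) (weight e)) + 2 * u)) ∎
          where
          double≡ : ∀ x → 2 * x ≡ x + x
          double≡ = solve-∀
          merge : ∀ c a b → c * (3 * a) + c * (3 * b) ≡ c * (3 * (a + b))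
          merge = solve-∀
          rest : ∑ (uncovered S) (weight e) ≤ 2 * u
          rest = ≤-trans (∑-mono∈ (uncovered S) (λ v v∈ → light e v e∈ v∈))
            (≤-reflexive (trans (∑-const (uncovered S) 2) (*-comm u 2)))

      few-singles : length is * h ≤ 6 * c * t
      few-singles = double-count is ts (λ x t → ∑ (triVertices t) (m x)) 1 c h u lower singles-light
        where
        lower : ∀ x → x ∈ is → 1 * (c * (4 * (t * 3 + u)) + h) ≤ c * (3 * (∑ ts (λ t → ∑ (triVertices t) (m x)) + 1 * u))
        lower x x∈ = begin
          1 * (c * (4 * (t * 3 + u)) + h) ≡⟨ *-identityˡ _ ⟩
          c * (4 * (t * 3 + u)) + h ≡⟨ cong (λ z → c * (4 * z) + h) (sym (length-split S)) ⟩
          c * (4 * length xs) + h ≤⟨ degrees x (∈-resp-↭ (cover S) (∈-++⁺ʳ (T⁺ ts) (∈-++⁺ʳ (P⁺ ps) x∈))) ⟩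
          c * (3 * ∑ xs (m x)) ≡⟨ cong (λ z → c * (3 * z)) (split (m x)) ⟩
          c * (3 * (∑ ts (λ t → ∑ (triVertices t) (m x)) + ∑ (uncovered S) (m x)))
            ≤⟨ *-monoʳ-≤ c (*-monoʳ-≤ 3 (+-monoʳ-≤ (∑ ts (λ t → ∑ (triVertices t) (m x))) rest)) ⟩
          c * (3 * (∑ ts (λ t → ∑ (triVertices t) (m x)) + 1 * u)) ∎
          where
          pairs-part : ∀ qs → (∀ e → e ∈ qs → e ∈ ps) → ∑ (P⁺ qs) (m x) ≤ length qs * 2
          pairs-part [] _ = z≤n
          pairs-part ((p , q) ∷ qs) f = ≤-trans (≤-reflexive (sym (+-assoc (m x p) (m x q) _)))
            (+-mono-≤ (≤-trans (≤-reflexive (cong₂ _+_ (symmetric M x p) (symmetric M x q)))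
                (light (p , q) x (f _ (here refl)) (∈-++⁺ʳ (P⁺ ps) x∈)))
              (pairs-part qs (λ e e∈ → f e (there e∈))))
          -- A single sends at most 2 edges to a double edge and at most 1 to a single, hence on
          -- average at most one per uncovered vertex.
          rest : ∑ (uncovered S) (m x) ≤ 1 * u
          rest = begin
            ∑ (uncovered S) (m x) ≡⟨ ∑-++ (P⁺ ps) is (m x) ⟩
            ∑ (P⁺ ps) (m x) + ∑ is (m x) ≤⟨ +-mono-≤ (pairs-part ps (λ _ e∈ → e∈)) (∑-mono∈ is (λ y y∈ → single x y x∈ y∈)) ⟩
            length ps * 2 + ∑ is (λ _ → 1) ≡⟨ cong (length ps * 2 +_) (trans (∑-const is 1) (*-identityʳ _)) ⟩
            length ps * 2 + length is ≡⟨ sym (trans (*-identityˡ u) (length-uncovered S)) ⟩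
            1 * u ∎

-- Linking: codegrees in `H_M` and exchangeable pairs.

≡true⇒T : ∀ {b} → b ≡ true → T b
≡true⇒T refl = _

ι-∧ : ∀ a b → ι (a ∧ b) ≡ ι a * ι b
ι-∧ true b = sym (+-identityʳ (ι b))
ι-∧ false b = refl

-- Denominators are cleared: degrees are at least (4/3 + 1/e) n, and an admissible partition has at
-- least n²/a crossing edges of `H_M`. `D` is the common density constant: a set counts as large
-- from n/D vertices on.
module Linking {n : ℕ} (M : Multigraph n) (std : Standard M) (0<n : 0 < n)
  (e a D : ℕ) .{{_ : NonZero e}}
  (6e≤D : 6 * e ≤ D) (4a≤D : 4 * a ≤ D) (D-large : 432 * (a * (e * e) * (2 * a + 1)) < D)
  (degrees : ∀ x → (4 * e + 3) * n ≤ 3 * e * degree M x)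
  (unsplittable : ∀ A → n ≤ 3 * sizeOf A → n ≤ 3 * (n ∸ sizeOf A) → n * n ≤ a * crossEdgesH M A) where

  open Absorbing M D 0<n
  open NearTiling M std using (five; five-sound)

  private
    m : Fin n → Fin n → ℕ
    m = μ M

  h : Fin n → Fin n → ℕ
  h x y = ι (isDouble (m x y))

  h-sym : ∀ x y → h x y ≡ h y x
  h-sym x y = cong (λ k → ι (isDouble k)) (symmetric M x y)

  nbrs : Fin n → ℕ
  nbrs x = ∑ V (h x)

  codegree : Fin n → Fin n → ℕ
  codegree x y = ∑ V (λ u → h x u * h y u)

  -- Ordered pairs are counted, so this is twice the number of triangles of `H_M` at `x`.
  triangles : Fin n → ℕ
  triangles x = ∑ V (λ u → h x u * codegree x u)

  ∑V-affine : ∀ a b {f g : Fin n → ℕ} → (∀ x → f x ≤ a + b * g x) → ∑ V f ≤ n * a + b * ∑ V g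
  ∑V-affine a b {f} {g} p = subst (λ l → ∑ V f ≤ l * a + b * ∑ V g) (length-allFin n) (∑-affine V a b p)

  ∑V-const : ∀ c → ∑ V (λ _ → c) ≡ n * c
  ∑V-const c = trans (∑-const V c) (cong (_* c) (length-allFin n))

  ∑V-≤ : ∀ {f} c → (∀ x → f x ≤ c) → ∑ V f ≤ n * c
  ∑V-≤ c p = ≤-trans (∑-mono V p) (≤-reflexive (∑V-const c))

  size≤n : ∀ (A : Fin n → Bool) → sizeOf A ≤ n
  size≤n A = ≤-trans (∑V-≤ 1 (λ x → ι≤1 (A x))) (≤-reflexive (*-identityʳ n))

  -- A multiplicity is at most 1, plus 1 if it is double; so the degree in `H_M` is at least d(x) -
  -- n, which is at least (1/3 + 1/e) n.
  many-nbrs : ∀ x → (e + 3) * n ≤ 3 * e * nbrs x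
  many-nbrs x = linear ((e + 3) * n) (3 * e * nbrs x) 0
    (+-mono-≤ (degrees x) (*-monoʳ-≤ (3 * e) (∑V-affine 1 1 (λ y →
      ≤ᵇ⇒≤ (m x y) _ (check₁ (λ k → k ≤ᵇ 1 + 1 * ι (isDouble k)) _ (std x y))))))
    (identity e n (degree M x) (nbrs x))
    where
    identity : ∀ e n d N → (e + 3) * n + (3 * e * d + 3 * e * (n * 1 + 1 * N)) + 0
                         ≡ 3 * e * N + ((4 * e + 3) * n + 3 * e * d)
    identity = solve-∀

  n≤3nbrs : ∀ x → n ≤ 3 * nbrs x
  n≤3nbrs x = *-cancelˡ-≤ e (linear (e * n) (e * (3 * nbrs x)) (3 * n) (many-nbrs x) (identity e n (nbrs x)))
    where
    identity : ∀ e n N → e * n + 3 * e * N + 3 * n ≡ e * (3 * N) + (e + 3) * n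
    identity = solve-∀

  Heavy : Fin n → Fin n → Fin n → Fin n → Bool
  Heavy x y u v = 5 ≤ᵇ m x v + m y v + m u v

  -- The three degrees sum to at least (4 + 3/e) n, while a vertex receives at most 4 unless it is
  -- heavy, and then at most 6.
  many-heavy : ∀ x y u → 9 * n ≤ 6 * e * sizeOf (Heavy x y u)
  many-heavy x y u = linear (9 * n) (6 * e * s) 0
    (+-mono-≤ (+-mono-≤ (+-mono-≤ (degrees x) (degrees y)) (degrees u)) (*-monoʳ-≤ (3 * e) weights))
    (identity e n (degree M x) (degree M y) (degree M u) s)
    where
    s : ℕ
    s = sizeOf (Heavy x y u)
    weights : degree M x + degree M y + degree M u ≤ n * 4 + 2 * s
    weights = ≤-trans (≤-reflexive (sym (trans (∑-+ V (λ v → m x v + m y v) (m u)) (cong (_+ degree M u) (∑-+ V (m x) (m y))))))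
      (∑V-affine 4 2 (λ v → ≤ᵇ⇒≤ (m x v + m y v + m u v) _
        (check₃ (λ a b c → (a + b + c) ≤ᵇ (4 + 2 * ι (5 ≤ᵇ a + b + c))) _ (std x v) (std y v) (std u v))))
    identity : ∀ e n d₁ d₂ d₃ s →
      9 * n + (3 * e * d₁ + 3 * e * d₂ + 3 * e * d₃ + 3 * e * (n * 4 + 2 * s)) + 0 ≡
      6 * e * s + ((4 * e + 3) * n + (4 * e + 3) * n + (4 * e + 3) * n + 3 * e * (d₁ + d₂ + d₃))
    identity = solve-∀

  D-bound : ∀ k c s → suc k * n ≤ 6 * e * s + k * c → c ≤ n → n ≤ D * s
  D-bound k c s p c≤n = ≤-trans
    (linear n (6 * e * s) 0 (+-mono-≤ p (*-monoʳ-≤ k c≤n)) (identity n k c (6 * e * s)))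
    (*-monoˡ-≤ s 6e≤D)
    where
    identity : ∀ n k c s → n + (s + k * c + k * n) + 0 ≡ s + (suc k * n + k * c)
    identity = solve-∀

  heavy-set : ∀ x y u → n ≤ D * sizeOf (Heavy x y u)
  heavy-set x y u = D-bound 8 0 _ (≤-trans (many-heavy x y u) (≤-reflexive (sym (+-identityʳ _)))) z≤n

  -- Let `u` be a common double neighbour and `v` heavy for `x`, `y`, `u`. At most one of the three
  -- multiplicities at `v` is 1 and the others are 2, so `u`, `v` complete both `x` and `y`.
  codegree⇒exchange : ∀ x y → n ≤ D * codegree x y → Exchange 2 [ x ] [ y ]
  codegree⇒exchange x y big = (λ u → isDouble (m x u) ∧ isDouble (m y u)) ,
    ≤-trans big (≤-reflexive (cong (D *_) (∑-cong V (λ u → sym (ι-∧ (isDouble (m x u)) _))))) ,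
    λ u Au → Heavy x y u , heavy-set x y u , λ v Bv →
      let xu , yu = ∧≡true (isDouble (m x u)) (isDouble (m y u)) Au in
      tileable-triple (five-sound x u v
        (modus (modus {isDouble (m x u)} (check₄ (λ a c d f → isDouble a ⇒ᵇ (5 ≤ᵇ c + d + f) ⇒ᵇ five a f c) _
          (std x u) (std x v) (std y v) (std u v)) (≡true⇒T xu)) (≡true⇒T Bv))) ,
      tileable-triple (five-sound y u v
        (modus (modus {isDouble (m y u)} (check₄ (λ a c d f → isDouble a ⇒ᵇ (5 ≤ᵇ c + d + f) ⇒ᵇ five a f d) _
          (std y u) (std x v) (std y v) (std u v)) (≡true⇒T yu)) (≡true⇒T Bv)))

  -- Three neighbourhoods of at least (1/3 + 1/e) n vertices overlap so much that the three
  -- codegrees sum to at least 3n/e.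
  codegree-of-three : ∀ x y w → D * codegree x y < n → D * codegree x w < n → n ≤ D * codegree y w
  codegree-of-three x y w xy xw = linear n (D * yw) (6 * n)
    (+-mono-≤ (+-mono-≤ (<⇒≤ xy) (<⇒≤ xw)) (≤-trans sum≥ (*-monoˡ-≤ (xy′ + yw + xw′) e≤D)))
    (identity n D xy′ yw xw′)
    where
    xy′ yw xw′ : ℕ
    xy′ = codegree x y
    yw = codegree y w
    xw′ = codegree x w
    e≤D : 3 * e ≤ D
    e≤D = ≤-trans (*-monoˡ-≤ e (≤ᵇ⇒≤ 3 6 _)) 6e≤D
    pointwise : ∀ a b c → ι a + ι b + ι c ≤ 1 + 1 * (ι a * ι b + ι b * ι c + ι a * ι c)
    pointwise true true true = ≤ᵇ⇒≤ 3 4 _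
    pointwise true true false = ≤ᵇ⇒≤ 2 2 _
    pointwise true false true = ≤ᵇ⇒≤ 2 2 _
    pointwise true false false = ≤ᵇ⇒≤ 1 1 _
    pointwise false true true = ≤ᵇ⇒≤ 2 2 _
    pointwise false true false = ≤ᵇ⇒≤ 1 1 _
    pointwise false false true = ≤ᵇ⇒≤ 1 1 _
    pointwise false false false = z≤n
    union : nbrs x + nbrs y + nbrs w ≤ n * 1 + 1 * (xy′ + yw + xw′)
    union = ≤-trans (≤-reflexive (sym (trans (∑-+ V (λ u → h x u + h y u) (h w)) (cong (_+ nbrs w) (∑-+ V (h x) (h y))))))
      (≤-trans (∑V-affine 1 1 (λ u → pointwise (isDouble (m x u)) (isDouble (m y u)) (isDouble (m w u))))
        (≤-reflexive (cong (λ z → n * 1 + 1 * z)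
          (trans (∑-+ V (λ u → h x u * h y u + h y u * h w u) (λ u → h x u * h w u))
            (cong (_+ xw′) (∑-+ V (λ u → h x u * h y u) (λ u → h y u * h w u)))))))
    sum≥ : 9 * n ≤ 3 * e * (xy′ + yw + xw′)
    sum≥ = linear (9 * n) (3 * e * (xy′ + yw + xw′)) 0
      (+-mono-≤ (+-mono-≤ (+-mono-≤ (many-nbrs x) (many-nbrs y)) (many-nbrs w)) (*-monoʳ-≤ (3 * e) union))
      (identity₀ e n (nbrs x) (nbrs y) (nbrs w) (xy′ + yw + xw′))
      where
      identity₀ : ∀ e n a b c s →
        9 * n + (3 * e * a + 3 * e * b + 3 * e * c + 3 * e * (n * 1 + 1 * s)) + 0 ≡
        3 * e * s + ((e + 3) * n + (e + 3) * n + (e + 3) * n + 3 * e * (a + b + c))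
      identity₀ = solve-∀
    identity : ∀ n D a b c → n + (n + n + D * (a + b + c)) + 6 * n ≡ D * b + (D * a + D * c + 9 * n)
    identity = solve-∀

  not≡true : ∀ b → not b ≡ true → b ≡ false
  not≡true false _ = refl

  ≤ᵇ-true : ∀ {j k} → (j ≤ᵇ k) ≡ true → j ≤ k
  ≤ᵇ-true {j} {k} t = ≤ᵇ⇒≤ j k (≡true⇒T t)

  ≤ᵇ-false : ∀ {j k} → (j ≤ᵇ k) ≡ false → k < j
  ≤ᵇ-false {j} {k} f = ≰⇒> λ j≤k → subst T f (≤⇒≤ᵇ j≤k)

  Pivot : Fin n → Fin n → Fin n → Bool
  Pivot x y u = isDouble (m x u) ∧ (1 ≤ᵇ m y u)

  Good : Fin n → Fin n → Fin n → Fin n → Bool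
  Good x y u v = isDouble (m y v) ∧ isDouble (m u v) ∧ (1 ≤ᵇ m x v)

  GoodPivot BadPivot : Fin n → Fin n → Fin n → Bool
  GoodPivot x y u = Pivot x y u ∧ (n ≤ᵇ D * sizeOf (Good x y u))
  BadPivot x y u = Pivot x y u ∧ not (n ≤ᵇ D * sizeOf (Good x y u))

  ι-guard : ∀ b {c k} → (b ≡ true → c ≤ k) → ι b * c ≤ k
  ι-guard true {c} f = ≤-trans (≤-reflexive (+-identityʳ c)) (f refl)
  ι-guard false f = z≤n

  -- The vertices u with μ(x,u) = 2 and μ(y,u) ≥ 1 each have many heavy v. Either such a v makes a
  -- 5-triangle with u and y as well as with u and x, or it is a common double neighbour of x and u.
  exchange-or-triangles : ∀ x y →
    Exchange 2 [ x ] [ y ] ⊎ (D * codegree x y < n × n * n ≤ 36 * (e * e) * triangles x)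
  exchange-or-triangles x y with n ≤? D * codegree x y
  ... | yes big = inj₁ (codegree⇒exchange x y big)
  ... | no small with n ≤? D * sizeOf (GoodPivot x y)
  ... | yes big = inj₁ (GoodPivot x y , big , λ u P₁u →
    let Pu , Gbig = ∧≡true (Pivot x y u) _ P₁u
        xu , yu = ∧≡true (isDouble (m x u)) _ Pu
    in Good x y u , ≤ᵇ-true Gbig , λ v Guv →
      let yv , rest = ∧≡true (isDouble (m y v)) _ Guv
          uv , xv = ∧≡true (isDouble (m u v)) _ rest
      in tileable-triple (five-sound x u v
           (modus (modus (modus {isDouble (m x u)}
             (check₃ (λ a b c → isDouble a ⇒ᵇ isDouble b ⇒ᵇ (1 ≤ᵇ c) ⇒ᵇ five a b c) _ (std x u) (std u v) (std x v))
             (≡true⇒T xu)) (≡true⇒T uv)) (≡true⇒T xv))) ,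
         tileable-triple (five-sound y u v
           (modus (modus (modus {isDouble (m y v)}
             (check₃ (λ a b c → isDouble c ⇒ᵇ isDouble b ⇒ᵇ (1 ≤ᵇ a) ⇒ᵇ five a b c) _ (std y u) (std u v) (std y v))
             (≡true⇒T yv)) (≡true⇒T uv)) (≡true⇒T yu))))
  ... | no small₁ = inj₂ (≰⇒> small , many-triangles)
    where
    6e-small : ∀ {s} → D * s < n → 6 * e * s ≤ n
    6e-small {s} p = ≤-trans (*-monoˡ-≤ s 6e≤D) (<⇒≤ p)

    -- Here 2d(x) + d(y) is at least (4 + 3/e) n, and a vertex contributes at most 4 unless it is a
    -- pivot, and then at most 6.
    many-pivots : 9 * n ≤ 6 * e * sizeOf (Pivot x y)
    many-pivots = linear (9 * n) (6 * e * sizeOf (Pivot x y)) 0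
      (+-mono-≤ (+-mono-≤ (+-mono-≤ (degrees x) (degrees x)) (degrees y)) (*-monoʳ-≤ (3 * e) weights))
      (identity e n (degree M x) (degree M y) (sizeOf (Pivot x y)))
      where
      weights : 2 * degree M x + degree M y ≤ n * 4 + 2 * sizeOf (Pivot x y)
      weights = ≤-trans (≤-reflexive (sym (trans (∑-+ V (λ u → 2 * m x u) (m y)) (cong (_+ degree M y) (∑-*ˡ V 2 (m x))))))
        (∑V-affine 4 2 (λ u → ≤ᵇ⇒≤ (2 * m x u + m y u) _
          (check₂ (λ a b → (2 * a + b) ≤ᵇ (4 + 2 * ι (isDouble a ∧ (1 ≤ᵇ b)))) _ (std x u) (std y u))))
      identity : ∀ e n d₁ d₂ s → 9 * n + (3 * e * d₁ + 3 * e * d₁ + 3 * e * d₂ + 3 * e * (n * 4 + 2 * s)) + 0 ≡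
        6 * e * s + ((4 * e + 3) * n + (4 * e + 3) * n + (4 * e + 3) * n + 3 * e * (2 * d₁ + d₂))
      identity = solve-∀

    many-bad : n ≤ 6 * e * sizeOf (BadPivot x y)
    many-bad = linear n (6 * e * sizeOf (BadPivot x y)) (7 * n)
      (+-mono-≤ (≤-trans many-pivots (*-monoʳ-≤ (6 * e) split)) (6e-small (≰⇒> small₁)))
      (identity n (6 * e) (sizeOf (GoodPivot x y)) (sizeOf (BadPivot x y)))
      where
      pointwise : ∀ a b → ι a ≤ ι (a ∧ b) + ι (a ∧ not b)
      pointwise true true = ≤-refl
      pointwise true false = ≤-refl
      pointwise false b = z≤n
      split : sizeOf (Pivot x y) ≤ sizeOf (GoodPivot x y) + sizeOf (BadPivot x y)
      split = ≤-trans (∑-mono V (λ u → pointwise (Pivot x y u) _)) (≤-reflexive (∑-+ V (λ u → ι (GoodPivot x y u)) (λ u → ι (BadPivot x y u))))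
      identity : ∀ n c s₁ s₂ → n + (c * (s₁ + s₂) + n) + 7 * n ≡ c * s₂ + (9 * n + c * s₁)
      identity = solve-∀

    -- At a heavy `v` at most one of the edges to `x`, `y`, `u` fails to be double. So `v` is good,
    -- or a common double neighbour of `x`, `y`, or one of `x`, `u`; the first two classes are
    -- small.
    large-codegree : ∀ u → BadPivot x y u ≡ true → n ≤ 6 * e * codegree x u
    large-codegree u P₂u = linear n (6 * e * codegree x u) (6 * n)
      (+-mono-≤ (+-mono-≤ (≤-trans (many-heavy x y u) (*-monoʳ-≤ (6 * e) split)) (6e-small (≰⇒> small)))
        (6e-small (≤ᵇ-false (not≡true _ (proj₂ (∧≡true (Pivot x y u) _ P₂u))))))
      (identity n (6 * e) (sizeOf (Good x y u)) (codegree x y) (codegree x u))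
      where
      split : sizeOf (Heavy x y u) ≤ sizeOf (Good x y u) + codegree x y + codegree x u
      split = ≤-trans (∑-mono V (λ v → ≤ᵇ⇒≤ (ι (Heavy x y u v)) _
          (check₃ (λ c d f → ι (5 ≤ᵇ c + d + f) ≤ᵇ
              (ι (isDouble d ∧ isDouble f ∧ (1 ≤ᵇ c)) + ι (isDouble c) * ι (isDouble d) + ι (isDouble c) * ι (isDouble f)))
            _ (std x v) (std y v) (std u v))))
        (≤-reflexive (trans (∑-+ V (λ v → ι (Good x y u v) + h x v * h y v) (λ v → h x v * h u v))
          (cong (_+ codegree x u) (∑-+ V (λ v → ι (Good x y u v)) (λ v → h x v * h y v)))))
      identity : ∀ n c g p q → n + (c * (g + p + q) + n + n) + 6 * n ≡ c * q + (9 * n + c * p + c * g)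
      identity = solve-∀

    many-triangles : n * n ≤ 36 * (e * e) * triangles x
    many-triangles = begin
      n * n ≤⟨ *-monoˡ-≤ n many-bad ⟩
      6 * e * sizeOf (BadPivot x y) * n ≡⟨ *-assoc (6 * e) (sizeOf (BadPivot x y)) n ⟩
      6 * e * (sizeOf (BadPivot x y) * n) ≡⟨ cong (6 * e *_) (sym (∑-*ʳ V n (λ u → ι (BadPivot x y u)))) ⟩
      6 * e * ∑ V (λ u → ι (BadPivot x y u) * n) ≤⟨ *-monoʳ-≤ (6 * e) (∑-mono V pointwise) ⟩
      6 * e * ∑ V (λ u → 6 * e * (h x u * codegree x u)) ≡⟨ cong (6 * e *_) (∑-*ˡ V (6 * e) _) ⟩
      6 * e * (6 * e * triangles x) ≡⟨ identity e (triangles x) ⟩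
      36 * (e * e) * triangles x ∎
      where
      open ≤-Reasoning
      identity : ∀ e t → 6 * e * (6 * e * t) ≡ 36 * (e * e) * t
      identity = solve-∀
      pointwise : ∀ u → ι (BadPivot x y u) * n ≤ 6 * e * (h x u * codegree x u)
      pointwise u = ι-guard (BadPivot x y u) λ P₂u →
        ≤-trans (large-codegree u P₂u) (≤-reflexive (cong (6 * e *_)
          (trans (sym (+-identityʳ _)) (cong (λ b → ι b * codegree x u) (sym (xu P₂u))))))
        where
        xu : BadPivot x y u ≡ true → isDouble (m x u) ≡ true
        xu P₂u = proj₁ (∧≡true (isDouble (m x u)) _ (proj₁ (∧≡true (Pivot x y u) _ P₂u)))

  -- The outcome of the alternative as a Boolean, so that the vertices linked to `x` form a vertex
  -- set. The value `false` yields triangles at the first argument, so the order of the arguments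
  -- matters.
  isR : Fin n → Fin n → Bool
  isR x y with exchange-or-triangles x y
  ... | inj₁ _ = true
  ... | inj₂ _ = false

  isR-true : ∀ x y → isR x y ≡ true → Exchange 2 [ x ] [ y ]
  isR-true x y t with exchange-or-triangles x y
  ... | inj₁ e = e

  isR-false : ∀ x y → isR x y ≡ false → D * codegree x y < n × n * n ≤ 36 * (e * e) * triangles x
  isR-false x y f with exchange-or-triangles x y
  ... | inj₂ p = p

  isR-codegree : ∀ x y → n ≤ D * codegree x y → isR x y ≡ true
  isR-codegree x y big with isR x y in eq
  ... | true = refl
  ... | false = ⊥-elim (<⇒≱ (proj₁ (isR-false x y eq)) big)

  codegree≤nbrs : ∀ x y → codegree x y ≤ nbrs x
  codegree≤nbrs x y = ∑-mono V (λ u → ≤-trans (*-monoʳ-≤ (h x u) (ι≤1 _)) (≤-reflexive (*-identityʳ (h x u))))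

  nbrs≤n : ∀ x → nbrs x ≤ n
  nbrs≤n x = size≤n (λ u → isDouble (m x u))

  -- The codegrees of x sum to at least nbrs x · (1/3 + 1/e) n.
  many-R : ∀ x → (2 * e + 3) * n ≤ 6 * e * sizeOf (isR x)
  many-R x = *-cancelˡ-≤ N {{N≢0}} (linear (N * ((2 * e + 3) * n)) (N * (6 * e * k)) 0
      (+-mono-≤ (+-mono-≤ (+-mono-≤ lower lower) upper) (*-monoˡ-≤ n (n≤3nbrs x)))
      (identity e n N k S))
    where
    N k S : ℕ
    N = nbrs x
    k = sizeOf (isR x)
    S = ∑ V (λ w → codegree x w)
    N≢0 : NonZero N
    N≢0 = >-nonZero (*-cancelˡ-< 3 0 N (≤-trans 0<n (n≤3nbrs x)))
    S≡ : S ≡ ∑ V (λ u → h x u * nbrs u)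
    S≡ = trans (∑-swap V V (λ w u → h x u * h w u))
      (∑-cong V (λ u → trans (∑-*ˡ V (h x u) (λ w → h w u)) (cong (h x u *_) (∑-cong V (λ w → h-sym w u)))))
    lower : N * ((e + 3) * n) ≤ 3 * e * S
    lower = begin
      N * ((e + 3) * n) ≡⟨ sym (∑-*ʳ V ((e + 3) * n) (h x)) ⟩
      ∑ V (λ u → h x u * ((e + 3) * n)) ≤⟨ ∑-mono V (λ u → *-monoʳ-≤ (h x u) (many-nbrs u)) ⟩
      ∑ V (λ u → h x u * (3 * e * nbrs u)) ≡⟨ ∑-cong V (λ u → comm (h x u) (3 * e) (nbrs u)) ⟩
      ∑ V (λ u → 3 * e * (h x u * nbrs u)) ≡⟨ ∑-*ˡ V (3 * e) _ ⟩
      3 * e * ∑ V (λ u → h x u * nbrs u) ≡⟨ cong (3 * e *_) (sym S≡) ⟩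
      3 * e * S ∎
      where
      open ≤-Reasoning
      comm : ∀ a b c → a * (b * c) ≡ b * (a * c)
      comm = solve-∀
    -- A linked vertex has codegree at most `N`, any other less than n/(6e). The resulting error n²
    -- is at most 3Nn.
    upper : 6 * e * S ≤ n * n + 6 * e * N * k
    upper = ≤-trans (≤-reflexive (sym (∑-*ˡ V (6 * e) _))) (∑V-affine n (6 * e * N) pointwise)
      where
      pointwise : ∀ w → 6 * e * codegree x w ≤ n + 6 * e * N * ι (isR x w)
      pointwise w with isR x w in eq
      ... | true = ≤-trans (*-monoʳ-≤ (6 * e) (codegree≤nbrs x w))
        (≤-trans (≤-reflexive (sym (*-identityʳ (6 * e * N)))) (m≤n+m _ n))
      ... | false = ≤-trans (*-monoˡ-≤ (codegree x w) 6e≤D)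
        (≤-trans (<⇒≤ (proj₁ (isR-false x w eq))) (m≤m+n n _))
    identity : ∀ e n N k S →
      N * ((2 * e + 3) * n) + (3 * e * S + 3 * e * S + (n * n + 6 * e * N * k) + 3 * N * n) + 0 ≡
      N * (6 * e * k) + (N * ((e + 3) * n) + N * ((e + 3) * n) + 6 * e * S + n * n)
    identity = solve-∀

  size-not : ∀ (A : Fin n → Bool) → sizeOf (λ x → not (A x)) ≡ n ∸ sizeOf A
  size-not A = trans (sym (m+n∸m≡n (sizeOf A) _)) (cong (_∸ sizeOf A)
    (trans (sym (∑-+ V (λ x → ι (A x)) (λ x → ι (not (A x)))))
      (trans (∑-cong V (λ x → one (A x))) (trans (∑V-const 1) (*-identityʳ n)))))
    where
    one : ∀ b → ι b + ι (not b) ≡ 1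
    one true = refl
    one false = refl

  -- Exchangeable pairs across a partition.

  module CrossPairs (A : Fin n → Bool) where

    α β : Fin n → ℕ
    α p = ι (A p)
    β p = ι (not (A p))

    CrossR : Fin n → Fin n → Bool
    CrossR p q = not (A q) ∧ isR p q

    Rich : Fin n → Bool
    Rich p = A p ∧ (n ≤ᵇ D * sizeOf (CrossR p))

    inside outside : Fin n → ℕ
    inside p = ∑ V (λ q → α q * h p q)
    outside p = ∑ V (λ q → β q * h p q)

    cross≡ : crossEdgesH M A ≡ ∑ V (λ p → α p * outside p)
    cross≡ = ∑-cong V λ p → trans (∑-cong V (pointwise p)) (∑-*ˡ V (α p) (λ q → β q * h p q))
      where
      pointwise : ∀ p q → (if A p then (if not (A q) then (if isDouble (m p q) then 1 else 0) else 0) else 0)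
                        ≡ α p * (β q * h p q)
      pointwise p q with A p | A q
      ... | false | _ = refl
      ... | true | true = refl
      ... | true | false = sym (trans (+-identityʳ _) (+-identityʳ _))

    Boundary : Fin n → Bool
    Boundary p = A p ∧ (n ≤ᵇ 2 * a * outside p)

    -- Vertices of `A` with many double neighbours outside `A` but few exchangeable partners there.
    -- If `Rich` is small, they supply more cherries than are possible.
    Critical : Fin n → Bool
    Critical p = Boundary p ∧ not (n ≤ᵇ D * sizeOf (CrossR p))

    -- Paths of length two in `H_M` with one end in `A` and the other outside; the centre may lie on
    -- either side.
    cherries : ℕ
    cherries = ∑ V (λ p → ∑ V (λ q → α p * (β q * codegree p q)))

    endings : Fin n → ℕ
    endings p = ∑ V (λ u → ∑ V (λ v → h p u * (h u v * β v)))

    outside≤n : ∀ p → outside p ≤ n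
    outside≤n p = ≤-trans (∑V-≤ 1 (λ q → *-mono-≤ (ι≤1 (not (A q))) (ι≤1 (isDouble (m p q))))) (≤-reflexive (*-identityʳ n))

    -- Vertices outside `Boundary` account for at most half of the n²/a crossing edges, and each
    -- boundary vertex for at most n.
    many-boundary : n * n ≤ a * crossEdgesH M A → n ≤ 2 * a * sizeOf Boundary
    many-boundary cross = *-cancelˡ-≤ n {{>-nonZero 0<n}}
      (linear (n * n) (n * (2 * a * s)) 0 (+-mono-≤ (+-mono-≤ cross cross) upper) (identity n a s (crossEdgesH M A)))
      where
      s : ℕ
      s = sizeOf Boundary
      upper : 2 * a * crossEdgesH M A ≤ n * n + 2 * a * n * s
      upper = ≤-trans (≤-reflexive (trans (cong (2 * a *_) cross≡) (sym (∑-*ˡ V (2 * a) _)))) (∑V-affine n (2 * a * n) pointwise)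
        where
        pointwise : ∀ p → 2 * a * (α p * outside p) ≤ n + 2 * a * n * ι (Boundary p)
        pointwise p with A p
        ... | false = ≤-trans (≤-reflexive (*-zeroʳ (2 * a))) z≤n
        ... | true with n ≤ᵇ 2 * a * outside p in eq
        ...   | true = ≤-trans (*-monoʳ-≤ (2 * a) (≤-trans (≤-reflexive (+-identityʳ _)) (outside≤n p)))
          (≤-trans (≤-reflexive (sym (*-identityʳ (2 * a * n)))) (m≤n+m _ n))
        ...   | false = ≤-trans (≤-reflexive (cong (2 * a *_) (+-identityʳ _)))
          (≤-trans (<⇒≤ (≤ᵇ-false {n} eq)) (m≤m+n n _))
      identity : ∀ n a s c → n * n + (a * c + a * c + (n * n + 2 * a * n * s)) + 0 ≡
        n * (2 * a * s) + (n * n + n * n + 2 * a * c)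
      identity = solve-∀

    -- Rich vertices number less than n/(4a), half of the lower bound n/(2a) for `Boundary`.
    many-critical : n ≤ 2 * a * sizeOf Boundary → D * sizeOf Rich < n → n ≤ 4 * a * sizeOf Critical
    many-critical boundary rich = linear n (4 * a * sizeOf Critical) 0
      (+-mono-≤ (+-mono-≤ (+-mono-≤ boundary boundary) (*-monoʳ-≤ (4 * a) split))
        (≤-trans (*-monoˡ-≤ (sizeOf Rich) 4a≤D) (<⇒≤ rich)))
      (identity n a (sizeOf Boundary) (sizeOf Critical) (sizeOf Rich))
      where
      pointwise : ∀ x y z → ι (x ∧ y) ≤ ι ((x ∧ y) ∧ not z) + ι (x ∧ z)
      pointwise true true true = ≤-refl
      pointwise true true false = ≤-refl
      pointwise true false z = z≤n
      pointwise false y z = z≤n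
      split : sizeOf Boundary ≤ sizeOf Critical + sizeOf Rich
      split = ≤-trans (∑-mono V (λ p → pointwise (A p) _ _)) (≤-reflexive (∑-+ V (λ p → ι (Critical p)) (λ p → ι (Rich p))))
      identity : ∀ n a b c r → n + (2 * a * b + 2 * a * b + 4 * a * (c + r) + n) + 0 ≡
        4 * a * c + (n + n + 4 * a * b + 4 * a * r)
      identity = solve-∀

    -- A vertex related to every `q` would be related to the whole complement of `A`, which has at
    -- least n/3 vertices, and so would not be critical. Some unrelated `q` therefore exists and
    -- forces triangles at `p`.
    critical-triangles : n ≤ 3 * sizeOf (λ q → not (A q)) → ∀ p → Critical p ≡ true →
      n * n ≤ 36 * (e * e) * triangles p
    critical-triangles large p crit
      with search {P = λ q → isR p q ≡ false} {Q = λ q → isR p q ≡ true} decide V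
      where
      decide : ∀ q → isR p q ≡ false ⊎ isR p q ≡ true
      decide q with isR p q
      ... | true = inj₂ refl
      ... | false = inj₁ refl
    ... | inj₁ (q , _ , f) = proj₂ (isR-false p q f)
    ... | inj₂ all = ⊥-elim (<⇒≱ (≤ᵇ-false {n} (not≡true _ (proj₂ (∧≡true (Boundary p) _ crit))))
      (≤-trans large (≤-trans (*-monoˡ-≤ _ 3≤D) (*-monoʳ-≤ D (≤-reflexive
        (∑-cong V (λ q → cong ι (sym (full (not (A q)) (all q (∈-allFin q)))))))))))
      where
      full : ∀ b {c} → c ≡ true → b ∧ c ≡ b
      full true eq = eq
      full false eq = refl
      3≤D : 3 ≤ D
      3≤D = ≤-trans (≤-trans (≤ᵇ⇒≤ 3 6 _) (m≤m*n 6 e)) 6e≤D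

    -- A triangle `p u v` with `v` in `A` leaves at most `inside p` choices for `v` and n for `u`;
    -- otherwise `p u v` is a path ending outside `A`.
    triangles≤ : ∀ p → triangles p ≤ n * inside p + endings p
    triangles≤ p = begin
      triangles p ≡⟨ ∑-cong V (λ u → sym (∑-*ˡ V (h p u) (λ v → h p v * h u v))) ⟩
      ∑ V (λ u → ∑ V (λ v → h p u * (h p v * h u v)))
        ≤⟨ ∑-mono V (λ u → ∑-mono V (λ v → pointwise (isDouble (m p u)) (isDouble (m p v)) (isDouble (m u v)) (A v))) ⟩
      ∑ V (λ u → ∑ V (λ v → α v * h p v + h p u * (h u v * β v))) ≡⟨ ∑-cong V (λ u → ∑-+ V _ _) ⟩
      ∑ V (λ u → inside p + ∑ V (λ v → h p u * (h u v * β v))) ≡⟨ ∑-+ V _ _ ⟩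
      ∑ V (λ _ → inside p) + endings p ≡⟨ cong (_+ endings p) (∑V-const (inside p)) ⟩
      n * inside p + endings p ∎
      where
      open ≤-Reasoning
      pointwise : ∀ a b c d → ι a * (ι b * ι c) ≤ ι d * ι b + ι a * (ι c * ι (not d))
      pointwise a true c true = ≤-trans (*-mono-≤ (ι≤1 a) (≤-trans (≤-reflexive (+-identityʳ _)) (ι≤1 c))) (m≤m+n 1 _)
      pointwise a false c d = ≤-trans (≤-reflexive (*-zeroʳ (ι a))) z≤n
      pointwise a true c false = *-monoʳ-≤ (ι a) (≤-reflexive (trans (+-identityʳ (ι c)) (sym (*-identityʳ (ι c)))))

    -- A cherry may be counted at its centre or at its end in A.
    centred≡ : ∑ V (λ p → inside p * outside p) ≡ cherries
    centred≡ = trans (∑-cong V expand) (trans (∑-swap V V _) (∑-cong V λ s → trans (∑-swap V V _) (∑-cong V (collect s))))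
      where
      expand : ∀ p → inside p * outside p ≡ ∑ V (λ s → ∑ V (λ q → (α s * h p s) * (β q * h p q)))
      expand p = trans (sym (∑-*ʳ V (outside p) (λ s → α s * h p s)))
        (∑-cong V (λ s → sym (∑-*ˡ V (α s * h p s) (λ q → β q * h p q))))
      collect : ∀ s q → ∑ V (λ p → (α s * h p s) * (β q * h p q)) ≡ α s * (β q * codegree s q)
      collect s q = trans (∑-cong V (λ p → trans (cong₂ (λ x y → (α s * x) * (β q * y)) (h-sym p s) (h-sym p q))
          (shuffle (α s) (h s p) (β q) (h q p))))
        (trans (∑-*ˡ V (α s) _) (cong (α s *_) (∑-*ˡ V (β q) _)))
        where
        shuffle : ∀ a b c d → (a * b) * (c * d) ≡ a * (c * (b * d))
        shuffle = solve-∀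

    ended≡ : ∑ V (λ p → α p * endings p) ≡ cherries
    ended≡ = ∑-cong V λ p → trans (cong (α p *_) (trans (∑-swap V V _) (∑-cong V (collect p))))
        (sym (∑-*ˡ V (α p) _))
      where
      collect : ∀ p v → ∑ V (λ u → h p u * (h u v * β v)) ≡ β v * codegree p v
      collect p v = trans (∑-cong V (λ u → trans (cong (λ x → h p u * (x * β v)) (h-sym u v))
          (shuffle (h p u) (h v u) (β v))))
        (∑-*ˡ V (β v) _)
        where
        shuffle : ∀ a b c → a * (b * c) ≡ c * (a * b)
        shuffle = solve-∀

    -- Each critical `p` has n²/(36e²) ordered triangles. Since n is at most 2a times `outside p`,
    -- the term n times `inside p` is bounded by 2a times the cherries centred at `p`; the term
    -- `endings p` counts cherries ending at `p`.
    many-cherries : n ≤ 3 * sizeOf (λ q → not (A q)) → n ≤ 4 * a * sizeOf Critical →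
      n * (n * n) ≤ 144 * (a * (e * e) * (2 * a + 1)) * cherries
    many-cherries large critical = begin
      n * (n * n) ≤⟨ *-monoˡ-≤ (n * n) critical ⟩
      4 * a * sizeOf Critical * (n * n) ≡⟨ *-assoc (4 * a) (sizeOf Critical) (n * n) ⟩
      4 * a * (sizeOf Critical * (n * n)) ≡⟨ cong (4 * a *_) (sym (∑-*ʳ V (n * n) (λ p → ι (Critical p)))) ⟩
      4 * a * ∑ V (λ p → ι (Critical p) * (n * n)) ≤⟨ *-monoʳ-≤ (4 * a) (∑-mono V (λ p → ι-guard (Critical p) (bound p))) ⟩
      4 * a * ∑ V (λ p → 36 * (e * e) * (2 * a * (inside p * outside p) + α p * endings p))
        ≡⟨ cong (4 * a *_) (trans (∑-*ˡ V (36 * (e * e)) _) (cong (36 * (e * e) *_)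
            (trans (∑-+ V (λ p → 2 * a * (inside p * outside p)) _)
              (cong₂ _+_ (trans (∑-*ˡ V (2 * a) _) (cong (2 * a *_) centred≡)) ended≡)))) ⟩
      4 * a * (36 * (e * e) * (2 * a * cherries + cherries)) ≡⟨ identity a e cherries ⟩
      144 * (a * (e * e) * (2 * a + 1)) * cherries ∎
      where
      open ≤-Reasoning
      identity : ∀ a e c → 4 * a * (36 * (e * e) * (2 * a * c + c)) ≡ 144 * (a * (e * e) * (2 * a + 1)) * c
      identity = solve-∀
      bound : ∀ p → Critical p ≡ true → n * n ≤ 36 * (e * e) * (2 * a * (inside p * outside p) + α p * endings p)
      bound p crit = ≤-trans (critical-triangles large p crit) (*-monoʳ-≤ (36 * (e * e))
        (≤-trans (triangles≤ p) (+-mono-≤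
          (≤-trans (*-monoˡ-≤ (inside p) (≤ᵇ-true {n} (proj₂ (∧≡true (A p) _ boundary))))
            (≤-reflexive (shuffle a (outside p) (inside p))))
          (≤-reflexive (trans (sym (+-identityʳ _)) (cong (λ b → ι b * endings p) (sym (proj₁ (∧≡true (A p) _ boundary)))))))))
        where
        boundary : Boundary p ≡ true
        boundary = proj₁ (∧≡true (Boundary p) _ crit)
        shuffle : ∀ a o i → 2 * a * o * i ≡ 2 * a * (i * o)
        shuffle = solve-∀

    -- Cherries over unrelated pairs, over related pairs whose end in `A` is not rich, and over rich
    -- ends number at most n³/D each.
    few-cherries : D * sizeOf Rich < n → D * cherries ≤ 3 * (n * (n * n))
    few-cherries rich = begin
      D * cherries ≡⟨ trans (sym (∑-*ˡ V D _)) (∑-cong V (λ p → sym (∑-*ˡ V D _))) ⟩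
      ∑ V (λ p → ∑ V (λ q → D * (α p * (β q * codegree p q)))) ≤⟨ ∑-mono V row ⟩
      ∑ V (λ p → n * n + n * (D * (α p * r p))) ≤⟨ ∑V-affine (n * n) n (λ p → ≤-refl) ⟩
      n * (n * n) + n * ∑ V (λ p → D * (α p * r p)) ≤⟨ +-monoʳ-≤ (n * (n * n)) (*-monoʳ-≤ n (∑V-affine n (D * n) poor)) ⟩
      n * (n * n) + n * (n * n + D * n * sizeOf Rich)
        ≤⟨ linear _ _ 0 (*-monoʳ-≤ (n * n) (<⇒≤ rich)) (identity n D (sizeOf Rich)) ⟩
      3 * (n * (n * n)) ∎
      where
      open ≤-Reasoning
      r : Fin n → ℕ
      r p = sizeOf (CrossR p)
      identity : ∀ n D s → n * (n * n) + n * (n * n + D * n * s) + n * n * n + 0 ≡ 3 * (n * (n * n)) + n * n * (D * s)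
      identity = solve-∀
      codegree≤n : ∀ p q → codegree p q ≤ n
      codegree≤n p q = ≤-trans (codegree≤nbrs p q) (nbrs≤n p)
      row : ∀ p → ∑ V (λ q → D * (α p * (β q * codegree p q))) ≤ n * n + n * (D * (α p * r p))
      row p = ≤-trans (∑V-affine n (n * (D * α p)) pointwise) (≤-reflexive (cong (n * n +_) (assoc n D (α p) (r p))))
        where
        assoc : ∀ n D a r → n * (D * a) * r ≡ n * (D * (a * r))
        assoc = solve-∀
        zero-case : ∀ D x k → D * (x * 0) ≤ k
        zero-case D x k = ≤-trans (≤-reflexive (trans (cong (D *_) (*-zeroʳ x)) (*-zeroʳ D))) z≤n
        pointwise : ∀ q → D * (α p * (β q * codegree p q)) ≤ n + n * (D * α p) * ι (CrossR p q)
        pointwise q with A q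
        ... | true = zero-case D (α p) _
        ... | false with isR p q in eq
        ...   | true = ≤-trans (≤-trans (*-monoʳ-≤ D (*-monoʳ-≤ (α p) (≤-trans (≤-reflexive (+-identityʳ _)) (codegree≤n p q))))
                  (≤-reflexive (rearrange D (α p) n))) (m≤n+m _ n)
          where
          rearrange : ∀ D a n → D * (a * n) ≡ n * (D * a) * 1
          rearrange = solve-∀
        ...   | false = ≤-trans (*-monoʳ-≤ D (≤-trans (*-monoˡ-≤ _ (ι≤1 (A p))) (≤-reflexive (trans (+-identityʳ _) (+-identityʳ _)))))
                  (≤-trans (<⇒≤ (proj₁ (isR-false p q eq))) (m≤m+n n _))
      poor : ∀ p → D * (α p * r p) ≤ n + D * n * ι (Rich p)
      poor p with A p
      ... | false = ≤-trans (≤-reflexive (*-zeroʳ D)) z≤n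
      ... | true with n ≤ᵇ D * sizeOf (CrossR p) in eq
      ...   | true = ≤-trans (*-monoʳ-≤ D (≤-trans (≤-reflexive (+-identityʳ _)) (size≤n (CrossR p))))
              (≤-trans (≤-reflexive (sym (*-identityʳ (D * n)))) (m≤n+m _ n))
      ...   | false = ≤-trans (≤-reflexive (cong (D *_) (+-identityʳ _)))
              (≤-trans (<⇒≤ (≤ᵇ-false {n} eq)) (m≤m+n n _))

    -- Otherwise the bounds n³/(144c) from below and 3n³/D from above on the number of cherries
    -- collide, because `D` exceeds 432c.
    many-rich : n * n ≤ a * crossEdgesH M A → n ≤ 3 * sizeOf (λ q → not (A q)) → n ≤ D * sizeOf Rich
    many-rich cross large with n ≤? D * sizeOf Rich
    ... | yes big = big
    ... | no small = ⊥-elim (<⇒≱ D-large (*-cancelʳ-≤ D _ (n * (n * n)) {{>-nonZero (*-mono-≤ 0<n (*-mono-≤ 0<n 0<n))}} (begin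
      D * (n * (n * n)) ≤⟨ *-monoʳ-≤ D (many-cherries large (many-critical (many-boundary cross) (≰⇒> small))) ⟩
      D * (144 * c * cherries) ≡⟨ shuffle D (144 * c) cherries ⟩
      144 * c * (D * cherries) ≤⟨ *-monoʳ-≤ (144 * c) (few-cherries (≰⇒> small)) ⟩
      144 * c * (3 * (n * (n * n))) ≡⟨ identity c (n * (n * n)) ⟩
      432 * c * (n * (n * n)) ∎)))
      where
      open ≤-Reasoning
      c : ℕ
      c = a * (e * e) * (2 * a + 1)
      shuffle : ∀ x y z → x * (y * z) ≡ y * (x * z)
      shuffle = solve-∀
      identity : ∀ c t → 144 * c * (3 * t) ≡ 432 * c * t
      identity = solve-∀

  -- Links between arbitrary vertices.

  exchange-sym : ∀ k x y → Exchange k x y → Exchange k y x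
  exchange-sym k x y = many-map k (λ _ (p , q) → q , p)

  -- Exchanging `u` with itself amounts to a dense family of 5-triangles at `u`; the codegree of `u`
  -- with itself is its degree in `H_M`.
  many-tiles : Many 3 Tileable
  many-tiles = (λ _ → true) ,
    ≤-trans (m≤n*m n D {{>-nonZero (≤-trans (s≤s z≤n) D-large)}}) (≤-reflexive (cong (D *_) (sym full))) ,
    λ u _ → many-map 2 {P = λ us → Tileable (u ∷ us) × Tileable (u ∷ us)} {Q = λ us → Tileable (u ∷ us)} (λ _ → proj₁) (codegree⇒exchange u u (loop u))
    where
    full : sizeOf {n} (λ _ → true) ≡ n
    full = trans (∑V-const 1) (*-identityʳ n)
    loop : ∀ u → n ≤ D * codegree u u
    loop u = ≤-trans (n≤3nbrs u) (*-mono-≤ 3≤D (∑-mono V (λ v → square (isDouble (m u v)))))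
      where
      square : ∀ b → ι b ≤ ι b * ι b
      square true = ≤-refl
      square false = ≤-refl
      3≤D : 3 ≤ D
      3≤D = ≤-trans (≤-trans (≤ᵇ⇒≤ 3 6 _) (m≤m*n 6 e)) 6e≤D

  -- A direct link has length 2, one through a single middle vertex 2 + 1 + 2 = 5, one through two
  -- middle vertices 2 + 1 + 5 = 8. Padding by tiles makes every length 8.
  exchange-any : ∀ x y → Exchange 8 [ x ] [ y ]
  exchange-any x y with isR x y in xRy
  ... | true = exchange-pad 5 3 {[ x ]} {[ y ]} (exchange-pad 2 3 {[ x ]} {[ y ]} (isR-true x y xRy) many-tiles) many-tiles
  ... | false with n ≤? 3 * (n ∸ sizeOf (isR x))
  ...   | no small = exchange-pad 5 3 {[ x ]} {[ y ]} (exchange-via 2 2 {x} {y} C many-C via) many-tiles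
    where
    C : Fin n → Bool
    C w = isR x w ∧ isR y w
    via : ∀ u → C u ≡ true → Exchange 2 [ x ] [ u ] × Exchange 2 [ u ] [ y ]
    via u Cu = let xu , yu = ∧≡true (isR x u) (isR y u) Cu in
      isR-true x u xu , exchange-sym 2 [ y ] [ u ] (isR-true y u yu)
    -- Fewer than n/3 vertices are unrelated to `x`, and at least (1/3 + 1/(2e)) n are related to
    -- `y`.
    many-C : n ≤ D * sizeOf C
    many-C = ≤-trans (linear n (6 * e * sizeOf C) (2 * n)
        (+-mono-≤ (+-mono-≤ (many-R y) (*-monoʳ-≤ (6 * e) split)) (*-monoʳ-≤ (2 * e) (<⇒≤ (≰⇒> small))))
        (identity e n (sizeOf (isR y)) (sizeOf C) (n ∸ sizeOf (isR x)))) (*-monoˡ-≤ (sizeOf C) 6e≤D)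
      where
      pointwise : ∀ p q → ι q ≤ ι (p ∧ q) + ι (not p)
      pointwise true q = m≤m+n _ _
      pointwise false true = ≤-refl
      pointwise false false = z≤n
      split : sizeOf (isR y) ≤ sizeOf C + (n ∸ sizeOf (isR x))
      split = ≤-trans (∑-mono V (λ w → pointwise (isR x w) (isR y w)))
        (≤-reflexive (trans (∑-+ V (λ w → ι (C w)) (λ w → ι (not (isR x w))))
          (cong (sizeOf C +_) (size-not (isR x)))))
      identity : ∀ e n y c k → n + (6 * e * y + 6 * e * (c + k) + 2 * e * n) + 2 * n ≡
        6 * e * c + ((2 * e + 3) * n + 6 * e * y + 2 * e * (3 * k))
      identity = solve-∀
  ...   | yes large = exchange-via 2 5 {x} {y} Rich (many-rich cross large′) λ u Ru →
      let xu , big = ∧≡true (isR x u) _ Ru in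
      isR-true x u xu , exchange-via 2 2 {u} {y} (CrossR u) (≤ᵇ-true {n} big) λ v uv →
        -- As `x` has small codegree with both `y` and `v`, the codegree of `y` and `v` is large.
        let xv , uRv = ∧≡true (not (isR x v)) _ uv in
        isR-true u v uRv ,
        exchange-sym 2 [ y ] [ v ] (isR-true y v (isR-codegree y v
          (codegree-of-three x y v (proj₁ (isR-false x y xRy)) (proj₁ (isR-false x v (not≡true _ xv))))))
    where
    open CrossPairs (isR x)
    large′ : n ≤ 3 * sizeOf (λ q → not (isR x q))
    large′ = ≤-trans large (≤-reflexive (cong (3 *_) (sym (size-not (isR x)))))
    cross : n * n ≤ a * crossEdgesH M (isR x)
    cross = unsplittable (isR x)
      (*-cancelˡ-≤ (2 * e) {{m*n≢0 2 e}} (linear (2 * e * n) (2 * e * (3 * sizeOf (isR x))) (3 * n) (many-R x)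
        (identity e n (sizeOf (isR x)))))
      large
      where
      identity : ∀ e n s → 2 * e * n + 6 * e * s + 3 * n ≡ 2 * e * (3 * s) + (2 * e + 3) * n
      identity = solve-∀

-- Numerical estimates: Bernoulli's inequality and geometric growth.

bernoulli : ∀ c i → c ^ i * (c + i) ≤ suc c ^ i * c
bernoulli c zero = ≤-reflexive (cong (_+ 0) (+-identityʳ c))
bernoulli c (suc i) = begin
  c * c ^ i * (c + suc i) ≤⟨ linear (c * c ^ i * (c + suc i)) (suc c * (c ^ i * (c + i))) (c ^ i * i) (≤-refl {0}) (identity c (c ^ i) i) ⟩
  suc c * (c ^ i * (c + i)) ≤⟨ *-monoʳ-≤ (suc c) (bernoulli c i) ⟩
  suc c * (suc c ^ i * c) ≡⟨ sym (*-assoc (suc c) (suc c ^ i) c) ⟩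
  suc c * suc c ^ i * c ∎
  where
  open ≤-Reasoning
  identity : ∀ c p i → c * p * (c + suc i) + 0 + p * i ≡ suc c * (p * (c + i)) + 0
  identity = solve-∀

-- Geometric growth beats the cube: with i ≥ 8 g³ K⁴ and n < g (i + 1) we have n³ K⁴ < i⁴, while
-- Bernoulli gives (i / K)⁴ ≤ (K / c)⁴ⁱ for K = c + 1.
growth : ∀ g .{{_ : NonZero g}} c n → g * suc (8 * (g * (g * g)) * suc c ^ 4) ≤ n →
  ∃ λ i → g * i ≤ n × n * (n * n) * c ^ (i * 4) < suc c ^ (i * 4)
growth g c n large = i , gi≤n , ≰⇒> λ h →
  contradict x bound (subst (_≤ n * (n * n) * x ^ 4) (sym (^-*-assoc (suc c) i 4))
    (subst (λ z → suc c ^ (i * 4) ≤ n * (n * n) * z) (sym (^-*-assoc c i 4)) h))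
  where
  B i x y : ℕ
  B = 8 * (g * (g * g)) * suc c ^ 4
  i = n / g
  x = c ^ i
  y = suc c ^ i
  n≡ : n ≡ n % g + i * g
  n≡ = m≡m%n+[m/n]*n n g
  gi≤n : g * i ≤ n
  gi≤n = ≤-trans (≤-reflexive (*-comm g i)) (≤-trans (m≤n+m (i * g) (n % g)) (≤-reflexive (sym n≡)))
  n<g[i+1] : n < g * suc i
  n<g[i+1] = ≤-trans (≤-reflexive (cong suc n≡)) (≤-trans (+-monoˡ-≤ (i * g) (m%n<n n g)) (≤-reflexive (*-comm (suc i) g)))
  B<i : B < i
  B<i = s≤s⁻¹ (*-cancelˡ-< g (suc B) (suc i) (≤-<-trans large n<g[i+1]))
  n≤2gi : n ≤ 2 * (g * i)
  n≤2gi = ≤-trans (<⇒≤ n<g[i+1]) (linear (g * suc i) (2 * (g * i)) 0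
    (*-monoʳ-≤ g (≤-trans (s≤s z≤n) B<i)) (identity g i))
    where
    identity : ∀ g i → g * suc i + g * i + 0 ≡ 2 * (g * i) + g * 1
    identity = solve-∀
  cube : n * (n * n) * suc c ^ 4 < i ^ 4
  cube = begin-strict
    n * (n * n) * suc c ^ 4 ≤⟨ *-monoˡ-≤ (suc c ^ 4) (*-mono-≤ n≤2gi (*-mono-≤ n≤2gi n≤2gi)) ⟩
    2 * (g * i) * (2 * (g * i) * (2 * (g * i))) * suc c ^ 4 ≡⟨ identity g i (suc c ^ 4) ⟩
    B * (i * (i * i)) <⟨ *-monoˡ-< (i * (i * i)) {{>-nonZero (*-mono-≤ 0<i (*-mono-≤ 0<i 0<i))}} B<i ⟩
    i * (i * (i * i)) ≡⟨ cong (λ z → i * (i * (i * z))) (sym (*-identityʳ i)) ⟩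
    i ^ 4 ∎
    where
    open ≤-Reasoning
    0<i : 0 < i
    0<i = ≤-trans (s≤s z≤n) B<i
    identity : ∀ g i k → 2 * (g * i) * (2 * (g * i) * (2 * (g * i))) * k ≡ 8 * (g * (g * g)) * k * (i * (i * i))
    identity = solve-∀
  fourth : ∀ a b → (a * b) ^ 4 ≡ a ^ 4 * b ^ 4
  fourth a b = identity a b
    where
    identity : ∀ a b → (a * b) * ((a * b) * ((a * b) * ((a * b) * 1))) ≡ a * (a * (a * (a * 1))) * (b * (b * (b * (b * 1))))
    identity = solve-∀
  bound : x ^ 4 * i ^ 4 ≤ y ^ 4 * suc c ^ 4
  bound = ≤-trans (≤-reflexive (sym (fourth x i))) (≤-trans (^-monoˡ-≤ 4 (≤-trans (*-monoʳ-≤ x (m≤n+m i c))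
    (≤-trans (bernoulli c i) (*-monoʳ-≤ y (n≤1+n c))))) (≤-reflexive (fourth y (suc c))))
  contradict : ∀ x → x ^ 4 * i ^ 4 ≤ y ^ 4 * suc c ^ 4 → y ^ 4 ≤ n * (n * n) * x ^ 4 → ⊥
  contradict zero _ h = <⇒≱ (m^n>0 y {{m^n≢0 (suc c) i}} 4) (≤-trans h (≤-reflexive (*-zeroʳ (n * (n * n)))))
  contradict x@(suc _) b h = <⇒≱ (*-monoʳ-< (x ^ 4) cube) (begin
    x ^ 4 * i ^ 4 ≤⟨ b ⟩
    y ^ 4 * suc c ^ 4 ≤⟨ *-monoˡ-≤ (suc c ^ 4) h ⟩
    n * (n * n) * x ^ 4 * suc c ^ 4 ≡⟨ rearrange (n * (n * n)) (x ^ 4) (suc c ^ 4) ⟩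
    x ^ 4 * (n * (n * n) * suc c ^ 4) ∎)
    where
    open ≤-Reasoning
    rearrange : ∀ a b c → a * b * c ≡ b * (a * c)
    rearrange = solve-∀

-- Assembly of the factor from integer parameters.

dominate : ∀ x y z → ∃ λ D → x ≤ D × y ≤ D × z < D
dominate x y z = suc (x + y + z) , m≤n⇒m≤1+n (≤-trans (m≤m+n x y) (m≤m+n (x + y) z)) ,
  m≤n⇒m≤1+n (≤-trans (m≤n+m y x) (m≤m+n (x + y) z)) , s≤s (m≤n+m z (x + y))

EventualFactor : ℕ → ℕ → Set
EventualFactor e a = Σ ℕ λ n₀ → ∀ n → n₀ ≤ n → 3 ∣ n →
  (M : Multigraph n) → Standard M → (∀ x → (4 * e + 3) * n ≤ 3 * e * degree M x) →
  (∀ A → n ≤ 3 * sizeOf A → n ≤ 3 * (n ∸ sizeOf A) → n * n ≤ a * crossEdgesH M A) →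
  FiveTriangleFactor M

-- An absorber has 3 + 3 · 8 = 27 vertices. With 2e layers of 4i rounds each, the room required for
-- selection is 2D · 27 · 4i · 2e = 432Dei, that is, `g * i`.
module Factor (e a D g c : ℕ) .{{_ : NonZero e}} .{{g≢0 : NonZero g}}
  (6e≤D : 6 * e ≤ D) (4a≤D : 4 * a ≤ D) (D-large : 432 * (a * (e * e) * (2 * a + 1)) < D)
  (g≡ : g ≡ 432 * (D * e)) (c≡ : suc c ≡ (2 * D) ^ 27) where

  threshold : ℕ
  threshold = g * suc (8 * (g * (g * g)) * suc c ^ 4)

  module _ {n : ℕ} (n₀≤n : threshold ≤ n) (3∣n : 3 ∣ n) (M : Multigraph n) (std : Standard M)
    (degrees : ∀ x → (4 * e + 3) * n ≤ 3 * e * degree M x)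
    (unsplittable : ∀ A → n ≤ 3 * sizeOf A → n ≤ 3 * (n ∸ sizeOf A) → n * n ≤ a * crossEdgesH M A) where

    private
      0<n : 0 < n
      0<n = ≤-trans (>-nonZero⁻¹ threshold {{m*n≢0 g _}}) n₀≤n

    open Absorbing M D 0<n
    open Linking M std 0<n e a D 6e≤D 4a≤D D-large degrees unsplittable
    open NearTiling M std hiding (five; five-sound; five-complete)
    open Tiling

    factor : FiveTriangleFactor M
    factor =
      let i , gi≤n , few = growth g c n n₀≤n
          W , R , V↭ , small , absorb = Layers.absorbing-set 27
            (many-absorbers 8 many-tiles exchange-any) c c≡
            (2 * e) (i * 4) few [] V ↭-refl
            (≤-trans (≤-reflexive (budget i)) gi≤n)
          S , saturated = saturated-tiling {R}
          -- The excess n per vertex leaves at most 6e vertices uncovered, which is 2e triples.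
          few-left = few-uncovered {R} e n (λ x _ → degrees-in W R V↭ (W-small i W gi≤n small) x) S saturated
          U = uncovered S
          -- Absorbing nothing shows that `W` itself is tileable. So 3 divides its length, and hence
          -- the number of uncovered vertices.
          divides r U≡ = 3∣uncovered W R V↭ (absorb 0 [] z≤n refl) S
      in finish W R V↭ S (absorb r U (*-cancelʳ-≤ r (2 * e) 3 (≤-trans (≤-reflexive (sym U≡))
           (few-left′ R (length U) (R≤n W R V↭) few-left))) U≡)
      where
      budget : ∀ i → 2 * D * (0 + 27 * (i * 4) * (2 * e)) ≡ g * i
      budget i = trans (identity D e i) (cong (_* i) (sym g≡))
        where
        identity : ∀ d e i → 2 * d * (0 + 27 * (i * 4) * (2 * e)) ≡ 432 * (d * e) * i
        identity = solve-∀

      n≡ : ∀ W R → V ↭ W ++ R → length W + length R ≡ n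
      n≡ W R p = trans (sym (length-++ W)) (trans (sym (↭-length p)) (length-allFin n))

      R≤n : ∀ W R → V ↭ W ++ R → length R ≤ n
      R≤n W R p = ≤-trans (m≤n+m (length R) (length W)) (≤-reflexive (n≡ W R p))

      W-small : ∀ i W → g * i ≤ n → length W ≤ 27 * (i * 4) * (2 * e) → 6 * e * length W ≤ n
      W-small i W gi≤n small = ≤-trans (*-mono-≤ (≤-trans 6e≤D (m≤m+n D _)) small)
        (≤-trans (≤-reflexive (budget i)) gi≤n)

      -- Deleting `W` lowers a degree by at most twice its length, which costs at most n of the
      -- excess 3n.
      degrees-in : ∀ W R → V ↭ W ++ R → 6 * e * length W ≤ n → ∀ x →
        e * (4 * length R) + n ≤ e * (3 * ∑ R (μ M x))
      degrees-in W R p small x = linear (e * (4 * length R) + n) (e * (3 * r)) n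
        (+-mono-≤ (+-mono-≤ (+-mono-≤ (≤-trans (degrees x) (≤-reflexive (cong (3 * e *_) split)))
            (*-monoʳ-≤ (3 * e) (∑-≤const W (std x)))) small)
          (*-monoʳ-≤ (4 * e) (R≤n W R p)))
        (identity e n (length R) (length W) (∑ W (μ M x)) r)
        where
        r : ℕ
        r = ∑ R (μ M x)
        split : degree M x ≡ ∑ W (μ M x) + r
        split = trans (∑-↭ (μ M x) p) (∑-++ W R (μ M x))
        identity : ∀ e n l w s r →
          e * (4 * l) + n + (3 * e * (s + r) + 3 * e * (w * 2) + n + 4 * e * n) + n ≡
          e * (3 * r) + ((4 * e + 3) * n + 3 * e * s + 6 * e * w + 4 * e * l)
        identity = solve-∀

      few-left′ : ∀ R u → length R ≤ n → u * n ≤ 6 * e * length R → u ≤ 2 * e * 3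
      few-left′ R u R≤n h = ≤-trans (*-cancelʳ-≤ u (6 * e) n {{>-nonZero 0<n}} (≤-trans h (*-monoʳ-≤ (6 * e) R≤n)))
        (≤-reflexive (identity e))
        where
        identity : ∀ e → 6 * e ≡ 2 * e * 3
        identity = solve-∀

      3∣uncovered : ∀ W R → V ↭ W ++ R → Tileable W → (S : Tiling R) → 3 ∣ length (uncovered S)
      3∣uncovered W R p tW S = ∣m+n∣m⇒∣n (∣m+n∣m⇒∣n (subst (3 ∣_)
          (trans (sym (n≡ W R p)) (cong (length W +_) (length-split S))) 3∣n) (3∣tileable tW))
        (n∣m*n (length (tiles S)))

      finish : ∀ W R → V ↭ W ++ R → (S : Tiling R) → Tileable (uncovered S ++ W) → Tileable V
      finish W R p S tUW = tileable-↭
        (↭-trans (regroup tiled (uncovered S) W) (↭-trans (++⁺ˡ W (cover S)) (↭-sym p)))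
        (tileable-++ (tiles S , ↭-refl , tile S) tUW)
        where
        open ↭-Solver
        tiled : List (Fin n)
        tiled = concatMap triVertices (tiles S)
        regroup : ∀ T U W → T ++ (U ++ W) ↭ W ++ (T ++ U)
        regroup = bagSolve 3 (λ T U W → T ⊕ (U ⊕ W) ⊜ W ⊕ (T ⊕ U)) ↭-refl

  eventual-factor : EventualFactor e a
  eventual-factor = threshold , λ n n₀≤n → factor n₀≤n

five-triangle-factor : ∀ e a .{{_ : NonZero e}} → EventualFactor e a
five-triangle-factor e a with dominate (6 * e) (4 * a) (432 * (a * (e * e) * (2 * a + 1)))
... | D , 6e≤D , 4a≤D , D-large = Factor.eventual-factor e a D (432 * (D * e)) (pred ((2 * D) ^ 27))
  {{g≢0 = m*n≢0 432 (D * e) {{_}} {{m*n≢0 D e}}}} 6e≤D 4a≤D D-large refl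
  (suc-pred ((2 * D) ^ 27) {{m^n≢0 (2 * D) 27 {{m*n≢0 2 D}}}})
  where
  instance
    D≢0 : NonZero D
    D≢0 = >-nonZero (≤-trans (s≤s z≤n) D-large)

-- From rational to integer parameters.

toℚᵘ-ℕ : ∀ k → toℚᵘ (ℕtoℚ k) ℚᵘ.≃ mkℚᵘ (ℤ.+ k) 0
toℚᵘ-ℕ k = ℚ.toℚᵘ-fromℚᵘ (mkℚᵘ (ℤ.+ k) 0)

ℕtoℚ-mono : ∀ {j k} → j ≤ k → ℕtoℚ j ℚ.≤ ℕtoℚ k
ℕtoℚ-mono {j} {k} j≤k = ℚ.toℚᵘ-cancel-≤ (ℚᵘ.≤-respˡ-≃ (ℚᵘ.≃-sym (toℚᵘ-ℕ j)) (ℚᵘ.≤-respʳ-≃ (ℚᵘ.≃-sym (toℚᵘ-ℕ k))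
  (ℚᵘ.*≤* (ℤ.*-monoʳ-≤-nonNeg (ℤ.+ 1) (ℤ.+≤+ j≤k)))))

-- The numerator of ε is at least 1, so ε is at least the reciprocal of its denominator.
degree-bound : ∀ p e-1 .(cop : Coprime (suc p) (suc e-1)) n d →
  ((ℤ.+ 4 ℚ./ 3) ℚ.+ mkℚ (ℤ.+ suc p) e-1 cop) ℚ.* ℕtoℚ n ℚ.≤ ℕtoℚ d →
  (4 * suc e-1 + 3) * n ≤ 3 * suc e-1 * d
degree-bound p e-1 cop n d h = unpack (ℚᵘ.≤-respˡ-≃ lhs (ℚᵘ.≤-respʳ-≃ (toℚᵘ-ℕ d) (ℚ.toℚᵘ-mono-≤ h)))
  where
  ε : ℚ
  ε = mkℚ (ℤ.+ suc p) e-1 cop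
  lhs : toℚᵘ (((ℤ.+ 4 ℚ./ 3) ℚ.+ ε) ℚ.* ℕtoℚ n) ℚᵘ.≃ (mkℚᵘ (ℤ.+ 4) 2 ℚᵘ.+ mkℚᵘ (ℤ.+ suc p) e-1) ℚᵘ.* mkℚᵘ (ℤ.+ n) 0
  lhs = ℚᵘ.≃-trans (ℚ.toℚᵘ-homo-* ((ℤ.+ 4 ℚ./ 3) ℚ.+ ε) (ℕtoℚ n))
    (ℚᵘ.*-cong (ℚ.toℚᵘ-homo-+ (ℤ.+ 4 ℚ./ 3) ε) (toℚᵘ-ℕ n))
  unpack : (mkℚᵘ (ℤ.+ 4) 2 ℚᵘ.+ mkℚᵘ (ℤ.+ suc p) e-1) ℚᵘ.* mkℚᵘ (ℤ.+ n) 0 ℚᵘ.≤ mkℚᵘ (ℤ.+ d) 0 →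
    (4 * suc e-1 + 3) * n ≤ 3 * suc e-1 * d
  unpack (ℚᵘ.*≤* i) = linear ((4 * suc e-1 + 3) * n) (3 * suc e-1 * d) (p * 3 * n)
    (ℤ.drop‿+≤+ (subst₂ ℤ._≤_ eq (sym (ℤ.pos-* d (3 * suc e-1 * 1))) i))
    (identity e-1 p n d)
    where
    eq : ((ℤ.+ 4 ℤ.* ℤ.+ suc e-1) ℤ.+ (ℤ.+ suc p ℤ.* ℤ.+ 3)) ℤ.* ℤ.+ n ℤ.* ℤ.+ 1 ≡ ℤ.+ ((4 * suc e-1 + suc p * 3) * n * 1)
    eq = trans (cong (ℤ._* ℤ.+ 1) (sym (ℤ.pos-* (4 * suc e-1 + suc p * 3) n)))
      (sym (ℤ.pos-* ((4 * suc e-1 + suc p * 3) * n) 1))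
    identity : ∀ e p n d → (4 * suc e + 3) * n + d * (3 * suc e * 1) + p * 3 * n
                         ≡ 3 * suc e * d + (4 * suc e + suc p * 3) * n * 1
    identity = solve-∀

cross-bound : ∀ p a-1 .(cop : Coprime (suc p) (suc a-1)) j k → k * suc a-1 ≤ j → ℕtoℚ k ℚ.≤ mkℚ (ℤ.+ suc p) a-1 cop ℚ.* ℕtoℚ j
cross-bound p a-1 cop j k h = ℚ.toℚᵘ-cancel-≤ (ℚᵘ.≤-respˡ-≃ (ℚᵘ.≃-sym (toℚᵘ-ℕ k)) (ℚᵘ.≤-respʳ-≃ (ℚᵘ.≃-sym rhs) (ℚᵘ.*≤* bound)))
  where
  α : ℚ
  α = mkℚ (ℤ.+ suc p) a-1 cop
  rhs : toℚᵘ (α ℚ.* ℕtoℚ j) ℚᵘ.≃ mkℚᵘ (ℤ.+ suc p) a-1 ℚᵘ.* mkℚᵘ (ℤ.+ j) 0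
  rhs = ℚᵘ.≃-trans (ℚ.toℚᵘ-homo-* α (ℕtoℚ j)) (ℚᵘ.*-cong (ℚᵘ.≃-refl {mkℚᵘ (ℤ.+ suc p) a-1}) (toℚᵘ-ℕ j))
  bound : ℤ.+ k ℤ.* ℤ.+ (suc a-1 * 1) ℤ.≤ ℤ.+ suc p ℤ.* ℤ.+ j ℤ.* ℤ.+ 1
  bound = subst₂ ℤ._≤_ (ℤ.pos-* k (suc a-1 * 1))
    (trans (ℤ.pos-* (suc p * j) 1) (cong (ℤ._* ℤ.+ 1) (ℤ.pos-* (suc p) j)))
    (ℤ.+≤+ (linear (k * (suc a-1 * 1)) (suc p * j * 1) (p * j) h (identity k a-1 p j)))
    where
    identity : ∀ k a p j → k * (suc a * 1) + j + p * j ≡ suc p * j * 1 + k * suc a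
    identity = solve-∀

theorem21 : (ε α : ℚ) → 0ℚ ℚ.< ε → 0ℚ ℚ.< α →
    Σ ℕ λ n₀ → ∀ (n : ℕ) → n₀ ≤ n → 3 ∣ n →
    (M : Multigraph n) → Standard M →
    MinDegreeAtLeast M ((ℤ.+ 4 ℚ./ 3 ℚ.+ ε) ℚ.* ℕtoℚ n) →
    ¬ AlphaSplittableH M α →
    FiveTriangleFactor M
theorem21 (mkℚ (ℤ.+ suc p) e-1 cε) (mkℚ (ℤ.+ suc q) a-1 cα) _ _ =
  let n₀ , factor = five-triangle-factor (suc e-1) (suc a-1) in
  n₀ , λ n n₀≤n 3∣n M std deg unsplit →
    factor n n₀≤n 3∣n M std (λ x → degree-bound p e-1 cε n (degree M x) (deg x))
      -- Fewer than n²/a crossing edges would make `A` and its complement a witness of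
      -- splittability, as 1/a is at most α.
      λ A A-large B-large → ≮⇒≥ λ few → unsplit (A , ℕtoℚ-mono A-large , ℕtoℚ-mono B-large ,
        cross-bound q a-1 cα (n * n) (crossEdgesH M A) (≤-trans (≤-reflexive (*-comm (crossEdgesH M A) (suc a-1))) (<⇒≤ few)))
theorem21 (mkℚ (ℤ.+ zero) _ _) _ (ℚ.*<* (ℤ.+<+ ())) _
theorem21 (mkℚ ℤ.-[1+ _ ] _ _) _ (ℚ.*<* ()) _
theorem21 (mkℚ (ℤ.+ suc _) _ _) (mkℚ (ℤ.+ zero) _ _) _ (ℚ.*<* (ℤ.+<+ ()))
theorem21 (mkℚ (ℤ.+ suc _) _ _) (mkℚ ℤ.-[1+ _ ] _ _) _ (ℚ.*<* ())
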